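{- There exists a randomized algorithm that, given any $d$-regular bipartite graph $G=(P,Q,E)$ with $|P|=|Q|=n$ in adjacency array representation, finds a perfect matching of $G$ in $O(n\log n)$ expected time. Here the constant implied by $O(\cdot)$ is absolute (in particular independent of $d$).
   Context: A bipartite graph $G=(P,Q,E)$ has vertex set $P\cup Q$ and edge set $E\subseteq P\times Q$; it is $d$-regular if every vertex has degree $d$ (with $d \ge 1$). Regularity forces $|P|=|Q|$, and $n$ denotes this common value, so $G$ has $nd$ edges. Adjacency array representation: for each vertex, its $d$ neighbors are stored in an array, so that the $i$-th neighbor of a given vertex can be accessed in constant time; no assumption is made on the order of the neighbors within an array. Time is measured in the unit-cost random access machine model, where a uniformly random entry of an array can be drawn in constant time. The expectation is over the internal randomness of the algorithm, for a worst-case input. -}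

module Defs where

open import Data.Bool.Base using (Bool; T; if_then_else_)
open import Data.Fin.Base using (Fin; toℕ; fromℕ<)
open import Data.Fin.Subset using (∣_∣)
open import Data.Integer.Base using (+_)
open import Data.List.Base using (List; []; _∷_)
open import Data.Maybe.Base using (Maybe; just; nothing)
open import Data.Nat.Base using (ℕ; zero; suc; _+_; _∸_)
open import Data.Nat.Properties using (_≟_; _<?_)
open import Data.Product.Base using (∃; _×_; _,_; proj₁; proj₂; map₁)
open import Data.Product using (∃!)
open import Data.Rational.Base as ℚ using (ℚ)
open import Data.Rational.Properties using (+-0-commutativeMonoid)
open import Data.Vec.Base using (Vec; lookup; _[_]≔_; replicate; tabulate)
open import Function.Bundles using (_⇔_)
open import Function.Definitions using (Injective)
open import Relation.Binary.PropositionalEquality.Core using (_≡_)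
open import Relation.Nullary.Decidable.Core using (does; yes; no)

open import Algebra.Properties.CommutativeMonoid.Sum +-0-commutativeMonoid
  using (sum)

------------------------------------------------------------------------
-- Bipartite graphs

record BipartiteGraph (p q : ℕ) : Set where
  field
    edge : Fin p → Fin q → Bool

  Edge : Fin p → Fin q → Set
  Edge u v = T (edge u v)

  degreeP : Fin p → ℕ
  degreeP u = ∣ tabulate (λ v → edge u v) ∣

  degreeQ : Fin q → ℕ
  degreeQ v = ∣ tabulate (λ u → edge u v) ∣

record Regular {p q} (d : ℕ) (G : BipartiteGraph p q) : Set where
  open BipartiteGraph G
  field
    regularP : ∀ u → degreeP u ≡ d
    regularQ : ∀ v → degreeQ v ≡ d

record PerfectMatching {p q} (G : BipartiteGraph p q)
                       (M : Fin p → Fin q → Set) : Set where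
  open BipartiteGraph G
  field
    edges  : ∀ {u v} → M u v → Edge u v
    coverP : ∀ u → ∃! _≡_ λ v → M u v
    coverQ : ∀ v → ∃! _≡_ λ u → M u v

record AdjacencyArrays (n d : ℕ) : Set where
  field
    arrayP : Fin n → Fin d → Fin n
    arrayQ : Fin n → Fin d → Fin n

-- Each array lists the neighbours of its vertex exactly once, in an
-- arbitrary order; the arrays of the two sides are ordered independently.
record Represents {n d} (A : AdjacencyArrays n d)
                  (G : BipartiteGraph n n) : Set where
  open AdjacencyArrays A
  open BipartiteGraph G
  field
    distinctP : ∀ u → Injective _≡_ _≡_ (arrayP u)
    distinctQ : ∀ v → Injective _≡_ _≡_ (arrayQ v)
    listsP    : ∀ u v → Edge u v ⇔ (∃ λ i → arrayP u i ≡ v)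
    listsQ    : ∀ u v → Edge u v ⇔ (∃ λ i → arrayQ v i ≡ u)

------------------------------------------------------------------------
-- Finite randomized experiments

-- `uniform m k` draws i uniformly from the suc m elements of Fin (suc m),
-- independently of all earlier draws, and continues as k i.
data Rand (A : Set) : Set where
  return  : A → Rand A
  uniform : ∀ m → (Fin (suc m) → Rand A) → Rand A

infixl 1 _>>=_

_>>=_ : ∀ {A B} → Rand A → (A → Rand B) → Rand B
return a    >>= f = f a
uniform m k >>= f = uniform m (λ i → k i >>= f)

𝔼 : ∀ {A} → (A → ℚ) → Rand A → ℚ
𝔼 X (return a)    = X a
𝔼 X (uniform m k) = (+ 1 ℚ./ suc m) ℚ.* sum (λ i → 𝔼 X (k i))

-- As every branch has positive probability, this is "with probability 1".
data Always {A : Set} (P : A → Set) : Rand A → Set where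
  return  : ∀ {a} → P a → Always P (return a)
  uniform : ∀ {m k} → (∀ i → Always P (k i)) → Always P (uniform m k)

------------------------------------------------------------------------
-- Unit-cost random access machines

-- A machine with k registers and a memory indexed by ℕ, all of whose cells
-- hold natural numbers.  The instruction set has no multiplication, which
-- at unit cost on unbounded words would make the model unreasonably
-- powerful.  The input is read-only; vertices and array positions are
-- numbered from 0.
data Instr (k : ℕ) : Set where
  const  : (x : Fin k) (c : ℕ) → Instr k      -- x := c
  add    : (x y z : Fin k) → Instr k          -- x := y + z
  sub    : (x y z : Fin k) → Instr k          -- x := y ∸ z
  load   : (x y : Fin k) → Instr k            -- x := mem[y]
  store  : (x y : Fin k) → Instr k            -- mem[x] := y
  size   : (x : Fin k) → Instr k              -- x := n
  degree : (x : Fin k) → Instr k              -- x := d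
  nbrP   : (x y z : Fin k) → Instr k          -- x := arrayP[y][z]
  nbrQ   : (x y z : Fin k) → Instr k          -- x := arrayQ[y][z]
  rand   : (x y : Fin k) → Instr k            -- x := uniform on {0,…,y-1}
  jump   : (l : ℕ) → Instr k                  -- goto l
  jzero  : (x : Fin k) (l : ℕ) → Instr k      -- if x = 0 goto l
  halt   : Instr k

record Program : Set where
  field
    registers : ℕ
    code      : List (Instr registers)

record Config (k : ℕ) : Set where
  constructor config
  field
    pc   : ℕ
    regs : Vec ℕ k
    mem  : ℕ → ℕ

infixl 6 _[_↦_]

_[_↦_] : (ℕ → ℕ) → ℕ → ℕ → (ℕ → ℕ)
(m [ a ↦ v ]) b = if does (b ≟ a) then v else m b

-- Running off the end of the code halts.
fetch : ∀ {k} → List (Instr k) → ℕ → Instr k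
fetch []       _       = halt
fetch (i ∷ is) zero    = i
fetch (i ∷ is) (suc l) = fetch is l

-- Reads outside the array yield 0.
entry : ∀ {n d m} → (Fin n → Fin d → Fin m) → ℕ → ℕ → ℕ
entry {n} {d} a u i with u <? n | i <? d
... | yes u<n | yes i<d = toℕ (a (fromℕ< u<n) (fromℕ< i<d))
... | _       | _       = 0

-- A draw from the empty range yields 0.
draw : ℕ → Rand ℕ
draw zero    = return 0
draw (suc m) = uniform m (λ i → return (toℕ i))

module _ {n d : ℕ} (A : AdjacencyArrays n d) where
  open AdjacencyArrays A

  exec : ∀ {k} → Instr k → Config k → Maybe (Rand (Config k))
  exec {k} i (config pc r m) = go i
    where
    set : Fin k → ℕ → Config k
    set x v = config (suc pc) (r [ x ]≔ v) m

    go : Instr k → Maybe (Rand (Config k))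
    go (const x c)  = just (return (set x c))
    go (add x y z)  = just (return (set x (lookup r y + lookup r z)))
    go (sub x y z)  = just (return (set x (lookup r y ∸ lookup r z)))
    go (load x y)   = just (return (set x (m (lookup r y))))
    go (store x y)  = just (return (config (suc pc) r (m [ lookup r x ↦ lookup r y ])))
    go (size x)     = just (return (set x n))
    go (degree x)   = just (return (set x d))
    go (nbrP x y z) = just (return (set x (entry arrayP (lookup r y) (lookup r z))))
    go (nbrQ x y z) = just (return (set x (entry arrayQ (lookup r y) (lookup r z))))
    go (rand x y)   = just (draw (lookup r y) >>= λ v → return (set x v))
    go (jump l)     = just (return (config l r m))
    go (jzero x l)  =
      just (return (config (if does (lookup r x ≟ 0) then l else suc pc) r m))
    go halt         = nothing

  module _ (p : Program) where
    open Program p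

    step : Config registers → Maybe (Rand (Config registers))
    step c = exec (fetch code (Config.pc c)) c

    Halted : Config registers → Set
    Halted c = step c ≡ nothing

    initial : Config registers
    initial = config 0 (replicate registers 0) (λ _ → 0)

    -- Execution cut off after N instructions: the number min(T,N) of
    -- instructions executed, T being the running time, and the
    -- configuration reached.
    run : ℕ → Config registers → Rand (ℕ × Config registers)
    run zero    c = return (0 , c)
    run (suc N) c with step c
    ... | nothing = return (0 , c)
    ... | just r  = r >>= λ c′ → run N c′ >>= λ o → return (map₁ suc o)

    -- 𝔼[T] ≤ b, where 𝔼[T] is the supremum over N of 𝔼[min(T,N)] (monotone
    -- convergence).  In particular T is almost surely finite.
    ExpectedTime≤ : ℚ → Set
    ExpectedTime≤ b =
      ∀ N → 𝔼 (λ o → + proj₁ o ℚ./ 1) (run N initial) ℚ.≤ b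

    -- The edge set {(u , mem[u])}, read off the first n memory cells.
    output : Config registers → Fin n → Fin n → Set
    output c u v = Config.mem c (toℕ u) ≡ toℕ v

    FindsPerfectMatching : BipartiteGraph n n → Set
    FindsPerfectMatching G =
      ∀ N → Always (λ o → Halted (proj₂ o) → PerfectMatching G (output (proj₂ o)))
                   (run N initial)

module Submission where

-- The program maintains a matching and enlarges it by one edge per phase.  A
-- phase draws vertices of P until it meets an unmatched one, s, and then walks:
-- at the vertex u of P it draws a neighbour v of u and, if v is matched, goes on
-- from the mate of v.  The walk ends at the first unmatched v.  Only the most
-- recent departure `next u` from each u is remembered.  Following these pointers
-- from s erases the loops of the walk (path-extend, path-finish); what remains is
-- an augmenting path no longer than the walk, and the matching is switched along
-- it.
--
-- Let h N u be the expected length of the walk from u, cut off after N steps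
-- (walkTime).  Each vertex of Q is the target of d of the nd equally likely
-- steps, so summing the recursion for h over all u gives
--
--   sum of h (N+1) u over P  ≤  n + sum of h N u over the matched u.
--
-- As h grows with N, the matched vertices cancel, and the sum of h N u over the
-- unmatched u is at most n (sum-free-walkTime).  When k vertices are unmatched, a
-- walk from a random one of them thus has expected length at most n/k, and n/k is
-- also the expected number of draws needed to find an unmatched vertex
-- (sample-bound).  Over all phases this amounts to n times the harmonic number of
-- n, which is at most 1 + ⌈log₂ n⌉ (H≤1+log).
--
-- The running time is controlled by judgements `Safe N c b`: runs of at most N
-- instructions from c give a correct result if they halt, and take expected time
-- at most b.  They are established by induction on N for bounds b that account
-- for the work still to be done, so that no statement about infinite runs is
-- needed.  Correctness follows from the invariants Idle, Walking and Shifting,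
-- which hold at the heads of the loops.  As the walk leaves only s and matched
-- vertices, and s is matched in the end, the vertices of P without a pointer
-- between phases are exactly the unmatched ones; this is how s is recognized.

open import Defs
open import Algebra.Bundles using (CommutativeRing)
open import Data.Bool.Base using (Bool; true; false; not; if_then_else_)
open import Data.Bool.Properties using (T-≡)
open import Data.Fin.Base using (Fin; zero; suc; toℕ; punchOut)
open import Data.Fin.Patterns using (0F; 1F; 2F; 3F; 4F; 5F; 6F; 7F; 8F; 9F)
open import Data.Fin.Properties as Fin
  using (toℕ-injective; toℕ<n; fromℕ<-toℕ; any?; punchOut-injective; injective⇒≤)
open import Data.Fin.Subset using (∣_∣)
open import Data.Integer.Base as ℤ using (+_)
import Data.Integer.Properties as ℤ
open import Data.List.Base using ([]; _∷_)
open import Data.Maybe.Base using (Maybe; just; nothing; maybe′; is-nothing)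
open import Data.Maybe.Properties using (just-injective)
open import Data.Nat.Base as ℕ using (ℕ; zero; suc; _*_; NonZero)
open import Data.Nat.Induction using (<-rec)
open import Data.Nat.Logarithm using (⌈log₂_⌉; ⌈log₂⌈n/2⌉⌉≡⌈log₂n⌉∸1)
import Data.Nat.Properties as ℕ
open import Data.Product.Base using (∃; _×_; _,_; proj₁; proj₂; map₁)
open import Data.Product using (∃!)
open import Data.Rational.Base as ℚ using (ℚ; 0ℚ; 1ℚ; _/_; _+_; _≤_; toℚᵘ)
  renaming (_*_ to infixl 7 _·_)
open import Data.Rational.Properties
open import Data.Rational.Solver using (module +-*-Solver)
import Data.Rational.Unnormalised.Base as ℚᵘ
import Data.Rational.Unnormalised.Properties as ℚᵘ
open import Data.Sum.Base using (_⊎_; inj₁; inj₂)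
open import Data.Vec.Base using ([]; _∷_; lookup; tabulate)
open import Data.Vec.Functional using (updateAt)
open import Data.Vec.Functional.Properties using (updateAt-updates; updateAt-minimal)
open import Function.Base using (_∘_)
open import Function.Bundles using (module Equivalence)
open import Function.Definitions using (Injective)
open import Relation.Binary.PropositionalEquality
  using (_≡_; _≢_; refl; sym; trans; cong; cong₂; subst)
open import Relation.Nullary using (contradiction; yes; no)
open import Relation.Nullary.Decidable using (dec-true; dec-false)

open import Algebra.Properties.Semiring.Sum (CommutativeRing.semiring +-*-commutativeRing)
  using (sum; sum-cong-≗; ∑-distrib-+; ∑-comm; *-distribˡ-sum)

------------------------------------------------------------------------
-- Natural numbers among the rationals

ι : ℕ → ℚ
ι k = + k / 1

toℚᵘ-ι : ∀ k → toℚᵘ (ι k) ℚᵘ.≃ ℚᵘ.mkℚᵘ (+ k) 0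
toℚᵘ-ι k = toℚᵘ-fromℚᵘ (ℚᵘ.mkℚᵘ (+ k) 0)

ι-+ : ∀ a b → ι (a ℕ.+ b) ≡ ι a + ι b
ι-+ a b = toℚᵘ-injective (begin
  toℚᵘ (ι (a ℕ.+ b))                        ≈⟨ toℚᵘ-ι (a ℕ.+ b) ⟩
  ℚᵘ.mkℚᵘ (+ (a ℕ.+ b)) 0
    ≈⟨ ℚᵘ.*≡* (cong (ℤ._* + 1) (cong₂ ℤ._+_ (sym (ℤ.*-identityʳ (+ a))) (sym (ℤ.*-identityʳ (+ b))))) ⟩
  ℚᵘ.mkℚᵘ (+ a) 0 ℚᵘ.+ ℚᵘ.mkℚᵘ (+ b) 0      ≈⟨ ℚᵘ.+-cong (toℚᵘ-ι a) (toℚᵘ-ι b) ⟨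
  toℚᵘ (ι a) ℚᵘ.+ toℚᵘ (ι b)                ≈⟨ toℚᵘ-homo-+ (ι a) (ι b) ⟨
  toℚᵘ (ι a + ι b)                          ∎)
  where open ℚᵘ.≃-Reasoning

ι-* : ∀ a b → ι (a * b) ≡ ι a · ι b
ι-* a b = toℚᵘ-injective (begin
  toℚᵘ (ι (a * b))                          ≈⟨ toℚᵘ-ι (a * b) ⟩
  ℚᵘ.mkℚᵘ (+ (a * b)) 0                     ≈⟨ ℚᵘ.*≡* (cong (ℤ._* + 1) (ℤ.pos-* a b)) ⟩
  ℚᵘ.mkℚᵘ (+ a) 0 ℚᵘ.* ℚᵘ.mkℚᵘ (+ b) 0      ≈⟨ ℚᵘ.*-cong (toℚᵘ-ι a) (toℚᵘ-ι b) ⟨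
  toℚᵘ (ι a) ℚᵘ.* toℚᵘ (ι b)                ≈⟨ toℚᵘ-homo-* (ι a) (ι b) ⟨
  toℚᵘ (ι a · ι b)                          ∎)
  where open ℚᵘ.≃-Reasoning

ι-mono : ∀ {a b} → a ℕ.≤ b → ι a ≤ ι b
ι-mono {a} {b} a≤b = toℚᵘ-cancel-≤ (begin
  toℚᵘ (ι a)        ≃⟨ toℚᵘ-ι a ⟩
  ℚᵘ.mkℚᵘ (+ a) 0   ≤⟨ ℚᵘ.*≤* (ℤ.*-monoʳ-≤-nonNeg (+ 1) (ℤ.+≤+ a≤b)) ⟩
  ℚᵘ.mkℚᵘ (+ b) 0   ≃⟨ toℚᵘ-ι b ⟨
  toℚᵘ (ι b)        ∎)
  where open ℚᵘ.≤-Reasoning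

0≤ι : ∀ k → 0ℚ ≤ ι k
0≤ι k = ι-mono {0} {k} ℕ.z≤n

0≤1 : 0ℚ ≤ 1ℚ
0≤1 = 0≤ι 1

-- The reciprocal of suc m.
inv : ℕ → ℚ
inv m = + 1 / suc m

inv-inverse : ∀ m → inv m · ι (suc m) ≡ 1ℚ
inv-inverse m = toℚᵘ-injective (begin
  toℚᵘ (inv m · ι (suc m))              ≈⟨ toℚᵘ-homo-* (inv m) (ι (suc m)) ⟩
  toℚᵘ (inv m) ℚᵘ.* toℚᵘ (ι (suc m))    ≈⟨ ℚᵘ.*-cong (toℚᵘ-fromℚᵘ (ℚᵘ.mkℚᵘ (+ 1) m)) (toℚᵘ-ι (suc m)) ⟩
  ℚᵘ.mkℚᵘ (+ 1) m ℚᵘ.* ℚᵘ.mkℚᵘ (+ suc m) 0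
    ≈⟨ ℚᵘ.*≡* (trans (ℤ.*-identityʳ _) (trans (ℤ.*-identityˡ _) (sym (trans (ℤ.*-identityˡ _) (cong (+_ ∘ suc) (ℕ.*-identityʳ m)))))) ⟩
  ℚᵘ.1ℚᵘ                                ∎)
  where open ℚᵘ.≃-Reasoning

0≤inv : ∀ m → 0ℚ ≤ inv m
0≤inv m = nonNegative⁻¹ (inv m) {{normalize-nonNeg 1 (suc m)}}

0≤+ : ∀ {p q} → 0ℚ ≤ p → 0ℚ ≤ q → 0ℚ ≤ p + q
0≤+ = +-mono-≤

·-monoʳ-≤ : ∀ {r p q} → 0ℚ ≤ r → p ≤ q → r · p ≤ r · q
·-monoʳ-≤ {r} 0≤r = *-monoˡ-≤-nonNeg r {{ℚ.nonNegative 0≤r}}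

·-monoˡ-≤ : ∀ {r p q} → 0ℚ ≤ r → p ≤ q → p · r ≤ q · r
·-monoˡ-≤ {r} 0≤r = *-monoʳ-≤-nonNeg r {{ℚ.nonNegative 0≤r}}

0≤· : ∀ {p q} → 0ℚ ≤ p → 0ℚ ≤ q → 0ℚ ≤ p · q
0≤· {p} {q} 0≤p 0≤q = subst (_≤ p · q) (*-zeroʳ p) (·-monoʳ-≤ 0≤p 0≤q)

+-cancelʳ-≤ : ∀ r {p q} → p + r ≤ q + r → p ≤ q
+-cancelʳ-≤ r {p} {q} le =
  subst (_≤ q) (undo p) (subst (p + r + ℚ.- r ≤_) (undo q) (+-monoˡ-≤ (ℚ.- r) le))
  where
  undo : ∀ x → x + r + ℚ.- r ≡ x
  undo x = solve 2 (λ x r → x :+ r :+ (:- r) := x) refl x r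
    where open +-*-Solver

------------------------------------------------------------------------
-- Sums and averages

sum-mono : ∀ {n} {f g : Fin n → ℚ} → (∀ i → f i ≤ g i) → sum f ≤ sum g
sum-mono {zero}  f≤g = ≤-refl
sum-mono {suc n} f≤g = +-mono-≤ (f≤g zero) (sum-mono (f≤g ∘ suc))

ι-suc : ∀ k → ι (suc k) ≡ 1ℚ + ι k
ι-suc = ι-+ 1

sum-const : ∀ n c → sum {n} (λ _ → c) ≡ ι n · c
sum-const zero    c = sym (*-zeroˡ c)
sum-const (suc n) c = trans (cong (_+_ c) (sum-const n c)) (sym (trans (cong (_· c) (ι-suc n))
  (solve 2 (λ n c → (con 1ℚ :+ n) :* c := c :+ n :* c) refl (ι n) c)))
  where open +-*-Solver

-- The shape of 𝔼 at a uniform draw.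
avg : ∀ m → (Fin (suc m) → ℚ) → ℚ
avg m f = inv m · sum f

avg-mono : ∀ {m} {f g : Fin (suc m) → ℚ} → (∀ i → f i ≤ g i) → avg m f ≤ avg m g
avg-mono {m} f≤g = ·-monoʳ-≤ (0≤inv m) (sum-mono f≤g)

avg-affine : ∀ {m} b c (f : Fin (suc m) → ℚ) → avg m (λ i → c + b · f i) ≡ c + b · avg m f
avg-affine {m} b c f = trans (cong (inv m ·_) eq) (trans
  (solve 5 (λ v k c b s → v :* (k :* c :+ b :* s) := v :* k :* c :+ b :* (v :* s)) refl
    (inv m) (ι (suc m)) c b (sum f))
  (trans (cong (λ z → z · c + b · avg m f) (inv-inverse m)) (cong (_+ b · avg m f) (*-identityˡ c))))
  where
  open +-*-Solver
  eq : sum (λ i → c + b · f i) ≡ ι (suc m) · c + b · sum f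
  eq = trans (∑-distrib-+ (λ _ → c) (λ i → b · f i))
             (cong₂ _+_ (sum-const (suc m) c) (sym (*-distribˡ-sum b f)))

0≤avg : ∀ {m} {f : Fin (suc m) → ℚ} → (∀ i → 0ℚ ≤ f i) → 0ℚ ≤ avg m f
0≤avg {m} {f} 0≤f = 0≤· (0≤inv m) (subst (_≤ sum f) (trans (sum-const (suc m) 0ℚ) (*-zeroʳ (ι (suc m)))) (sum-mono 0≤f))

inv-cancel : ∀ m x → inv m · (ι (suc m) · x) ≡ x
inv-cancel m x = trans (sym (*-assoc (inv m) (ι (suc m)) x))
                       (trans (cong (_· x) (inv-inverse m)) (*-identityˡ x))

+avg-≤ : ∀ {m} {f : Fin (suc m) → ℚ} c {b} →
         ι (suc m) · c + sum f ≤ ι (suc m) · b → c + avg m f ≤ b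
+avg-≤ {m} {f} c {b} le = begin
  c + avg m f                          ≡⟨ cong (_+ avg m f) (inv-cancel m c) ⟨
  inv m · (ι (suc m) · c) + avg m f    ≡⟨ *-distribˡ-+ (inv m) (ι (suc m) · c) (sum f) ⟨
  inv m · (ι (suc m) · c + sum f)      ≤⟨ ·-monoʳ-≤ (0≤inv m) le ⟩
  inv m · (ι (suc m) · b)              ≡⟨ inv-cancel m b ⟩
  b                                    ∎
  where open ≤-Reasoning

------------------------------------------------------------------------
-- Finite functions and memories

infixl 10 _⟨_≔_⟩

-- The function f with its value at i replaced by x.
_⟨_≔_⟩ : ∀ {n} {A : Set} → (Fin n → A) → Fin n → A → Fin n → A
f ⟨ i ≔ x ⟩ = updateAt f i (λ _ → x)

update-same : ∀ {n} {A : Set} (f : Fin n → A) i {x} → (f ⟨ i ≔ x ⟩) i ≡ x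
update-same f i = updateAt-updates i f

update-other : ∀ {n} {A : Set} (f : Fin n → A) {i j x} → j ≢ i → (f ⟨ i ≔ x ⟩) j ≡ f j
update-other f {i} {j} = updateAt-minimal j i f

update-inv : ∀ {n} {A : Set} (f : Fin n → A) i {j x y} → (f ⟨ i ≔ x ⟩) j ≡ y →
             (j ≡ i × x ≡ y) ⊎ (j ≢ i × f j ≡ y)
update-inv f i {j} eq with j Fin.≟ i
... | yes refl = inj₁ (refl , trans (sym (update-same f i)) eq)
... | no  j≢i  = inj₂ (j≢i , trans (sym (update-other f j≢i)) eq)

write-same : ∀ (m : ℕ → ℕ) a {x} → (m [ a ↦ x ]) a ≡ x
write-same m a {x} = cong (λ b → if b then x else m a) (dec-true (a ℕ.≟ a) refl)

write-other : ∀ (m : ℕ → ℕ) {a b x} → b ≢ a → (m [ a ↦ x ]) b ≡ m b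
write-other m {a} {b} {x} b≢a = cong (λ c → if c then x else m b) (dec-false (b ℕ.≟ a) b≢a)

-- If j were missed, punching it out would give an injection into a smaller set.
injective⇒surjective : ∀ {n} {f : Fin n → Fin n} → Injective _≡_ _≡_ f → ∀ j → ∃ λ i → f i ≡ j
injective⇒surjective {suc n} {f} inj j with any? (λ i → f i Fin.≟ j)
... | yes found  = found
... | no missing = contradiction
  (injective⇒≤ {f = λ i → punchOut (j≢f i)} (λ eq → inj (punchOut-injective (j≢f _) (j≢f _) eq))) ℕ.1+n≰n
  where
  j≢f : ∀ i → j ≢ f i
  j≢f i eq = missing (i , sym eq)

------------------------------------------------------------------------
-- Sums over subsets

infixr 8 _⊙_

-- The indicator of b times x, so that sum (λ i → S i ⊙ g i) is the sum of g
-- over the subset S.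
_⊙_ : Bool → ℚ → ℚ
true  ⊙ x = x
false ⊙ x = 0ℚ

⊙-monoʳ : ∀ b {x y} → x ≤ y → b ⊙ x ≤ b ⊙ y
⊙-monoʳ true  x≤y = x≤y
⊙-monoʳ false x≤y = ≤-refl

0≤⊙ : ∀ b {x} → 0ℚ ≤ x → 0ℚ ≤ b ⊙ x
0≤⊙ true  0≤x = 0≤x
0≤⊙ false 0≤x = ≤-refl

⊙-split : ∀ b x → x ≡ b ⊙ x + not b ⊙ x
⊙-split true  x = sym (+-identityʳ x)
⊙-split false x = sym (+-identityˡ x)

-- The number of elements of a subset given by its characteristic function.
card : ∀ {n} → (Fin n → Bool) → ℕ
card S = ∣ tabulate S ∣

sum-⊙-const : ∀ {n} (S : Fin n → Bool) c → sum (λ i → S i ⊙ c) ≡ ι (card S) · c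
sum-⊙-const {zero}  S c = sym (*-zeroˡ c)
sum-⊙-const {suc n} S c with S zero
... | false = trans (+-identityˡ _) (sum-⊙-const (S ∘ suc) c)
... | true  = trans (cong (_+_ c) (sum-⊙-const (S ∘ suc) c))
  (sym (trans (cong (_· c) (ι-suc k)) (solve 2 (λ n c → (con 1ℚ :+ n) :* c := c :+ n :* c) refl (ι k) c)))
  where
  open +-*-Solver
  k = card (S ∘ suc)

sum-delete : ∀ {n} (S : Fin n → Bool) (g : Fin n → ℚ) j → S j ≡ true →
             sum (λ i → S i ⊙ g i) ≡ g j + sum (λ i → (S ⟨ j ≔ false ⟩) i ⊙ g i)
sum-delete S g zero    Sj rewrite Sj = cong (_+_ (g zero)) (sym (+-identityˡ _))
sum-delete S g (suc j) Sj = trans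
  (cong (_+_ (S zero ⊙ g zero)) (sum-delete (S ∘ suc) (g ∘ suc) j Sj))
  (solve 3 (λ a b c → a :+ (b :+ c) := b :+ (a :+ c)) refl (S zero ⊙ g zero) (g (suc j)) _)
  where open +-*-Solver

card-delete : ∀ {n} (S : Fin n → Bool) j → S j ≡ true → card S ≡ suc (card (S ⟨ j ≔ false ⟩))
card-delete S zero    Sj rewrite Sj = refl
card-delete S (suc j) Sj with S zero
... | true  = cong suc (card-delete (S ∘ suc) j Sj)
... | false = card-delete (S ∘ suc) j Sj

card-full : ∀ n → card {n} (λ _ → true) ≡ n
card-full zero    = refl
card-full (suc n) = cong suc (card-full n)

card≡0⇒empty : ∀ {n} (S : Fin n → Bool) → card S ≡ 0 → ∀ i → S i ≡ false
card≡0⇒empty S eq i with S i in Si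
... | false = refl
... | true  = contradiction (trans (sym eq) (card-delete S i Si)) (λ ())

-- Injectivity of a partial function.
InjectiveWhereDefined : ∀ {a b} → (Fin a → Maybe (Fin b)) → Set
InjectiveWhereDefined f = ∀ {i i′ j} → f i ≡ just j → f i′ ≡ just j → i ≡ i′

-- Reindexing a sum of nonnegative terms along a partial injection into S.  It is
-- used both for the injective adjacency arrays and for the matching.
sum-injection : ∀ {a b} (f : Fin a → Maybe (Fin b)) → InjectiveWhereDefined f →
                (S : Fin b → Bool) → (∀ {i j} → f i ≡ just j → S j ≡ true) →
                (g : Fin b → ℚ) → (∀ j → 0ℚ ≤ g j) →
                sum (λ i → maybe′ g 0ℚ (f i)) ≤ sum (λ j → S j ⊙ g j)
sum-injection {zero} {b} f inj S into g 0≤g =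
  subst (_≤ sum (λ j → S j ⊙ g j)) (trans (sum-const b 0ℚ) (*-zeroʳ (ι b)))
    (sum-mono (λ j → 0≤⊙ (S j) (0≤g j)))
sum-injection {suc a} f inj S into g 0≤g with f zero in f0
... | nothing = subst (_≤ sum (λ j → S j ⊙ g j)) (sym (+-identityˡ _))
  (sum-injection (f ∘ suc) (λ p q → Fin.suc-injective (inj p q)) S into g 0≤g)
... | just k = subst (_ ≤_) (sym (sum-delete S g k (into f0))) (+-monoʳ-≤ (g k)
  (sum-injection (f ∘ suc) (λ p q → Fin.suc-injective (inj p q)) (S ⟨ k ≔ false ⟩) into′ g 0≤g))
  where
  into′ : ∀ {i j} → f (suc i) ≡ just j → (S ⟨ k ≔ false ⟩) j ≡ true
  into′ {i} {j} fi = trans (update-other S j≢k) (into fi)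
    where
    j≢k : j ≢ k
    j≢k refl = contradiction (inj f0 fi) (λ ())

------------------------------------------------------------------------
-- Harmonic numbers

-- The harmonic number 1 + 1/2 + ... + 1/k.
H : ℕ → ℚ
H zero    = 0ℚ
H (suc k) = H k + inv k

H-step : ∀ k → H k ≤ H (suc k)
H-step k = subst (_≤ H k + inv k) (+-identityʳ (H k)) (+-monoʳ-≤ (H k) (0≤inv k))

inv-anti : ∀ {a b} → a ℕ.≤ b → inv b ≤ inv a
inv-anti {a} {b} a≤b = subst (_≤ inv a) eq₁ (subst (inv a · ι (suc a) · inv b ≤_) eq₂ le)
  where
  open +-*-Solver
  le : inv a · ι (suc a) · inv b ≤ inv a · ι (suc b) · inv b
  le = ·-monoˡ-≤ (0≤inv b) (·-monoʳ-≤ (0≤inv a) (ι-mono {suc a} {suc b} (ℕ.s≤s a≤b)))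
  eq₁ : inv a · ι (suc a) · inv b ≡ inv b
  eq₁ = trans (cong (_· inv b) (inv-inverse a)) (*-identityˡ _)
  eq₂ : inv a · ι (suc b) · inv b ≡ inv a
  eq₂ = trans (solve 3 (λ x y z → x :* y :* z := x :* (z :* y)) refl (inv a) (ι (suc b)) (inv b))
              (trans (cong (inv a ·_) (inv-inverse b)) (*-identityʳ _))

-- Each of the last m terms of H (2m) is at most 1/(m+1).
H-double : ∀ m → H (m ℕ.+ m) ≤ H m + 1ℚ
H-double m = ≤-trans (go m) (+-monoʳ-≤ (H m) (last m))
  where
  open +-*-Solver
  go : ∀ j → H (j ℕ.+ m) ≤ H m + ι j · inv m
  go zero    = ≤-reflexive (solve 2 (λ h v → h := h :+ con 0ℚ :* v) refl (H m) (inv m))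
  go (suc j) = ≤-trans (+-mono-≤ (go j) (inv-anti (ℕ.m≤n+m m j))) (≤-reflexive
    (trans (solve 3 (λ h x v → h :+ x :* v :+ v := h :+ (con 1ℚ :+ x) :* v) refl (H m) (ι j) (inv m))
           (cong (λ z → H m + z · inv m) (sym (ι-suc j)))))
  last : ∀ m → ι m · inv m ≤ 1ℚ
  last m = ≤-trans (·-monoˡ-≤ (0≤inv m) (ι-mono {m} (ℕ.n≤1+n m)))
    (≤-reflexive (trans (*-comm (ι (suc m)) (inv m)) (inv-inverse m)))

H-mono : ∀ {a b} → a ℕ.≤ b → H a ≤ H b
H-mono = go ∘ ℕ.≤⇒≤′
  where
  go : ∀ {a b} → a ℕ.≤′ b → H a ≤ H b
  go (ℕ.≤′-reflexive refl) = ≤-refl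
  go (ℕ.≤′-step {m} le)    = ≤-trans (go le) (H-step m)

0≤H : ∀ k → 0ℚ ≤ H k
0≤H k = H-mono {0} {k} ℕ.z≤n

⌈log₂⌉-halve : ∀ n → ⌈log₂ (2 ℕ.+ n) ⌉ ≡ suc ⌈log₂ ℕ.⌈ 2 ℕ.+ n /2⌉ ⌉
⌈log₂⌉-halve n = sym (cong suc (⌈log₂⌈n/2⌉⌉≡⌈log₂n⌉∸1 (2 ℕ.+ n)))

-- Repeated halving: H n ≤ H (2⌈n/2⌉) ≤ H ⌈n/2⌉ + 1.
H≤1+log : ∀ n → H n ≤ 1ℚ + ι ⌈log₂ n ⌉
H≤1+log = <-rec _ go
  where
  open +-*-Solver
  go : ∀ n → (∀ {k} → k ℕ.< n → H k ≤ 1ℚ + ι ⌈log₂ k ⌉) → H n ≤ 1ℚ + ι ⌈log₂ n ⌉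
  go 0 rec = 0≤+ 0≤1 (0≤ι ⌈log₂ 0 ⌉)
  go 1 rec = ≤-reflexive refl
  go n@(suc (suc k)) rec = begin
    H n                              ≤⟨ H-mono n≤2m ⟩
    H (m ℕ.+ m)                      ≤⟨ H-double m ⟩
    H m + 1ℚ                         ≤⟨ +-monoˡ-≤ 1ℚ (rec (ℕ.⌈n/2⌉<n k)) ⟩
    1ℚ + ι ⌈log₂ m ⌉ + 1ℚ
      ≡⟨ solve 1 (λ x → con 1ℚ :+ x :+ con 1ℚ := con 1ℚ :+ (con 1ℚ :+ x)) refl (ι ⌈log₂ m ⌉) ⟩
    1ℚ + (1ℚ + ι ⌈log₂ m ⌉)          ≡⟨ cong (λ z → 1ℚ + z) (ι-suc ⌈log₂ m ⌉) ⟨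
    1ℚ + ι (suc ⌈log₂ m ⌉)           ≡⟨ cong (λ z → 1ℚ + ι z) (⌈log₂⌉-halve k) ⟨
    1ℚ + ι ⌈log₂ n ⌉                 ∎
    where
    open ≤-Reasoning
    m = ℕ.⌈ n /2⌉
    n≤2m : n ℕ.≤ m ℕ.+ m
    n≤2m = ℕ.≤-trans (ℕ.≤-reflexive (sym (ℕ.⌊n/2⌋+⌈n/2⌉≡n n))) (ℕ.+-monoˡ-≤ m (ℕ.⌊n/2⌋≤⌈n/2⌉ n))

n≤1+n*log : ∀ n → n ℕ.≤ 1 ℕ.+ n * ⌈log₂ n ⌉
n≤1+n*log 0 = ℕ.z≤n
n≤1+n*log 1 = ℕ.s≤s ℕ.z≤n
n≤1+n*log n@(suc (suc k)) =
  ℕ.m≤n⇒m≤1+n (subst (λ l → n ℕ.≤ n * l) (sym (⌈log₂⌉-halve k)) (ℕ.m≤m*n n (suc ⌈log₂ ℕ.⌈ n /2⌉ ⌉)))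

------------------------------------------------------------------------
-- The length of the random walk

-- The entries of the arrays, taken together, contain every vertex at most d
-- times.  Only this consequence of regularity matters for the walk; it is
-- expressed through sums of nonnegative weights.
Balanced : ∀ {n d} → (Fin n → Fin d → Fin n) → Set
Balanced {n} {d} arr = ∀ g → (∀ v → 0ℚ ≤ g v) → sum (λ u → sum (λ i → g (arr u i))) ≤ ι d · sum g

arrays-balanced : ∀ {n d} {G : BipartiteGraph n n} {A : AdjacencyArrays n d} →
                  Regular d G → Represents A G → Balanced (AdjacencyArrays.arrayP A)
arrays-balanced {n} {d} {G} {A} reg rep g 0≤g = begin
  sum (λ u → sum (λ i → g (arrayP u i)))
    ≤⟨ sum-mono (λ u → sum-injection (just ∘ arrayP u) (injective u) (edge u) (lists u) g 0≤g) ⟩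
  sum (λ u → sum (λ v → edge u v ⊙ g v))
    ≡⟨ ∑-comm (λ u v → edge u v ⊙ g v) ⟩
  sum (λ v → sum (λ u → edge u v ⊙ g v))
    ≡⟨ sum-cong-≗ (λ v → trans (sum-⊙-const (λ u → edge u v) (g v)) (cong (λ k → ι k · g v) (regularQ v))) ⟩
  sum (λ v → ι d · g v)
    ≡⟨ *-distribˡ-sum (ι d) g ⟨
  ι d · sum g ∎
  where
  open ≤-Reasoning
  open AdjacencyArrays A
  open BipartiteGraph G
  open Regular reg
  open Represents rep
  injective : ∀ u → InjectiveWhereDefined (just ∘ arrayP u)
  injective u p q = distinctP u (just-injective (trans p (sym q)))
  lists : ∀ u {i v} → just (arrayP u i) ≡ just v → edge u v ≡ true
  lists u {i} refl = Equivalence.to T-≡ (Equivalence.from (listsP u (arrayP u i)) (i , refl))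

-- The walk for a fixed matching: `mate v` is the partner of the vertex v of Q.
module Walk {n d} (arr : Fin n → Fin (suc d) → Fin n) (mate : Fin n → Maybe (Fin n)) where

  -- The expected number of steps of the walk from u, cut off after N steps.
  walkTime : ℕ → Fin n → ℚ
  walkTime zero    u = 0ℚ
  walkTime (suc N) u = 1ℚ + avg d (λ i → maybe′ (walkTime N) 0ℚ (mate (arr u i)))

  -- The expected number of steps after arriving at v; none if v is unmatched.
  onward : ℕ → Fin n → ℚ
  onward N v = maybe′ (walkTime N) 0ℚ (mate v)

  mutual
    0≤walkTime : ∀ N u → 0ℚ ≤ walkTime N u
    0≤walkTime zero    u = ≤-refl
    0≤walkTime (suc N) u = 0≤+ 0≤1 (0≤avg (λ i → 0≤onward N (arr u i)))

    0≤onward : ∀ N v → 0ℚ ≤ onward N v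
    0≤onward N v with mate v
    ... | nothing = ≤-refl
    ... | just u  = 0≤walkTime N u

  mutual
    walkTime-step : ∀ N u → walkTime N u ≤ walkTime (suc N) u
    walkTime-step zero    u = 0≤walkTime 1 u
    walkTime-step (suc N) u = +-monoʳ-≤ 1ℚ (avg-mono (λ i → onward-step N (arr u i)))

    onward-step : ∀ N v → onward N v ≤ onward (suc N) v
    onward-step N v with mate v
    ... | nothing = ≤-refl
    ... | just u  = walkTime-step N u

  sum-walkTime : Balanced arr → ∀ N → sum (walkTime (suc N)) ≤ ι n + sum (onward N)
  sum-walkTime balanced N = begin
    sum (walkTime (suc N))
      ≡⟨ ∑-distrib-+ (λ _ → 1ℚ) (λ u → inv d · sum (λ i → onward N (arr u i))) ⟩
    sum {n} (λ _ → 1ℚ) + sum (λ u → inv d · sum (λ i → onward N (arr u i)))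
      ≡⟨ cong₂ _+_ (trans (sum-const n 1ℚ) (*-identityʳ (ι n))) (sym (*-distribˡ-sum (inv d) (λ u → sum (λ i → onward N (arr u i))))) ⟩
    ι n + inv d · sum (λ u → sum (λ i → onward N (arr u i)))
      ≤⟨ +-monoʳ-≤ (ι n) (·-monoʳ-≤ (0≤inv d) (balanced (onward N) (0≤onward N))) ⟩
    ι n + inv d · (ι (suc d) · sum (onward N))
      ≡⟨ cong (_+_ (ι n)) (inv-cancel d (sum (onward N))) ⟩
    ι n + sum (onward N) ∎
    where open ≤-Reasoning

  -- The expected lengths of the walks from the unmatched vertices add up to at
  -- most n.
  sum-free-walkTime : Balanced arr → InjectiveWhereDefined mate →
    (free : Fin n → Bool) → (∀ {v u} → mate v ≡ just u → free u ≡ false) →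
    ∀ N → sum (λ u → free u ⊙ walkTime N u) ≤ ι n
  sum-free-walkTime balanced inj free matched N =
    ≤-trans (sum-mono (λ u → ⊙-monoʳ (free u) (walkTime-step N u))) (+-cancelʳ-≤ rest (begin
      sum (λ u → free u ⊙ walkTime (suc N) u) + rest
        ≡⟨ ∑-distrib-+ (λ u → free u ⊙ walkTime (suc N) u) (λ u → not (free u) ⊙ walkTime (suc N) u) ⟨
      sum (λ u → free u ⊙ walkTime (suc N) u + not (free u) ⊙ walkTime (suc N) u)
        ≡⟨ sum-cong-≗ (λ u → ⊙-split (free u) (walkTime (suc N) u)) ⟨
      sum (walkTime (suc N))
        ≤⟨ sum-walkTime balanced N ⟩
      ι n + sum (onward N)
        ≤⟨ +-monoʳ-≤ (ι n) (sum-injection mate inj (not ∘ free) (cong not ∘ matched) (walkTime N) (0≤walkTime N)) ⟩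
      ι n + sum (λ u → not (free u) ⊙ walkTime N u)
        ≤⟨ +-monoʳ-≤ (ι n) (sum-mono (λ u → ⊙-monoʳ (not (free u)) (walkTime-step N u))) ⟩
      ι n + rest ∎))
    where
    open ≤-Reasoning
    -- The contribution of the matched vertices, which cancels.
    rest = sum (λ u → not (free u) ⊙ walkTime (suc N) u)

------------------------------------------------------------------------
-- Runs cut off after a number of instructions

-- The number of instructions executed, as a rational.
cost : ∀ {C : Set} → ℕ × C → ℚ
cost o = ι (proj₁ o)

-- One more instruction raises the expected cost by one.
𝔼-tick : ∀ {C : Set} (r : Rand (ℕ × C)) →
         𝔼 cost (r >>= λ o → return (map₁ suc o)) ≡ 1ℚ + 𝔼 cost r
𝔼-tick (return o)    = ι-suc (proj₁ o)
𝔼-tick (uniform m k) = trans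
  (cong (inv m ·_) (sum-cong-≗ (λ i → trans (𝔼-tick (k i)) (cong (_+_ 1ℚ) (sym (*-identityˡ (𝔼 cost (k i))))))))
  (trans (avg-affine 1ℚ 1ℚ (λ i → 𝔼 cost (k i))) (cong (_+_ 1ℚ) (*-identityˡ (avg m (λ i → 𝔼 cost (k i))))))

Always-map : ∀ {A B : Set} {P : A → Set} {Q : B → Set} {f : A → B} {r : Rand A} →
             (∀ {a} → P a → Q (f a)) → Always P r → Always Q (r >>= λ a → return (f a))
Always-map imp (return p)  = return (imp p)
Always-map imp (uniform k) = uniform (λ i → Always-map imp (k i))

-- A calculus of correctness and cost of runs.  Post is required of the
-- configurations at which the program halts.
module Machine {n d} (A : AdjacencyArrays n d) (p : Program)
               (Post : Config (Program.registers p) → Set) where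
  open Program p

  Conf = Config registers

  -- Runs cut off after exactly M instructions satisfy Post if they have halted,
  -- and their expected length is at most b.
  record SafeAt (M : ℕ) (c : Conf) (b : ℚ) : Set where
    field
      correct : Always (λ o → Halted A p (proj₂ o) → Post (proj₂ o)) (run A p M c)
      fast    : 𝔼 cost (run A p M c) ≤ b
  open SafeAt public

  -- The closure of SafeAt under shorter runs.  It allows unused steps to be
  -- dropped, so only one instruction per loop has to consume the bound N.
  record Safe (N : ℕ) (c : Conf) (b : ℚ) : Set where
    constructor safely
    field upTo : ∀ {M} → M ℕ.≤ N → SafeAt M c b
  open Safe public

  safe-nonneg : ∀ {N c b} → Safe N c b → 0ℚ ≤ b
  safe-nonneg safe = fast (upTo safe ℕ.z≤n)

  safe-weaken : ∀ {N c b b′} → b ≤ b′ → Safe N c b → Safe N c b′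
  safe-weaken b≤b′ safe = safely λ M≤N → record
    { correct = correct (upTo safe M≤N) ; fast = ≤-trans (fast (upTo safe M≤N)) b≤b′ }

  safe-pred : ∀ {N c b} → Safe (suc N) c b → Safe N c b
  safe-pred safe = safely λ M≤N → upTo safe (ℕ.m≤n⇒m≤1+n M≤N)

  run-halted : ∀ M {c} → Halted A p c → run A p M c ≡ return (0 , c)
  run-halted zero            halted = refl
  run-halted (suc M) {c = c} halted rewrite halted = refl

  run-running : ∀ M {c r} → step A p c ≡ just r →
                run A p (suc M) c ≡ (r >>= λ c′ → run A p M c′ >>= λ o → return (map₁ suc o))
  run-running M {c} eq rewrite eq = refl

  safe-halt : ∀ {N c} → Halted A p c → Post c → Safe N c 0ℚ
  safe-halt halted post = safely λ {M} _ → record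
    { correct = subst (Always _) (sym (run-halted M halted)) (return (λ _ → post))
    ; fast    = ≤-reflexive (cong (𝔼 cost) (run-halted M halted)) }

  running : ∀ {c r} → step A p c ≡ just r → ∀ {b} → 0ℚ ≤ b → SafeAt 0 c b
  running eq 0≤b = record
    { correct = return (λ halted → contradiction (trans (sym eq) halted) (λ ())) ; fast = 0≤b }

  safe-zero : ∀ {c r b} → step A p c ≡ just r → 0ℚ ≤ b → Safe 0 c b
  safe-zero eq 0≤b = safely λ { ℕ.z≤n → running eq 0≤b }

  safe-step : ∀ {N c c′ b} → step A p c ≡ just (return c′) → Safe N c′ b → Safe (suc N) c (1ℚ + b)
  safe-step {N} {c} {c′} {b} eq safe = safely go
    where
    go : ∀ {M} → M ℕ.≤ suc N → SafeAt M c (1ℚ + b)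
    go {zero} _ = running eq (0≤+ 0≤1 (safe-nonneg safe))
    go {suc M} (ℕ.s≤s M≤N) = record
      { correct = subst (Always _) (sym (run-running M eq))
          (Always-map (λ h → h) (correct (upTo safe M≤N)))
      ; fast    = ≤-trans
          (≤-reflexive (trans (cong (𝔼 cost) (run-running M eq)) (𝔼-tick (run A p M c′))))
          (+-monoʳ-≤ 1ℚ (fast (upTo safe M≤N)))
      }

  safe-draw : ∀ {N c m} {c′ : Fin (suc m) → Conf} {b} →
              step A p c ≡ just (uniform m (λ i → return (c′ i))) →
              (∀ i → Safe N (c′ i) (b i)) → Safe (suc N) c (1ℚ + avg m b)
  safe-draw {N} {c} {m} {c′} {b} eq safe = safely go
    where
    go : ∀ {M} → M ℕ.≤ suc N → SafeAt M c (1ℚ + avg m b)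
    go {zero} _ = running eq (0≤+ 0≤1 (0≤avg (λ i → safe-nonneg (safe i))))
    go {suc M} (ℕ.s≤s M≤N) = record
      { correct = subst (Always _) (sym (run-running M eq))
          (uniform (λ i → Always-map (λ h → h) (correct (upTo (safe i) M≤N))))
      ; fast    = ≤-trans
          (≤-reflexive (trans (cong (𝔼 cost) (run-running M eq))
                              (𝔼-tick (uniform m (λ i → run A p M (c′ i))))))
          (+-monoʳ-≤ 1ℚ (avg-mono (λ i → fast (upTo (safe i) M≤N))))
      }

  -- The two outcomes of a conditional jump whose tested register is known.
  branch-zero : ∀ {N pc r m x l b} → fetch code pc ≡ jzero x l → lookup r x ≡ 0 →
                Safe N (config l r m) b → Safe N (config pc r m) (1ℚ + b)
  branch-zero {pc = pc} {r} {m} {x} {l} is-jzero is-zero safe = safe-pred (safe-step eq safe)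
    where
    eq : step A p (config pc r m) ≡ just (return (config l r m))
    eq rewrite is-jzero | is-zero = refl

  branch-suc : ∀ {N pc r m x l w b} → fetch code pc ≡ jzero x l → lookup r x ≡ suc w →
               Safe N (config (suc pc) r m) b → Safe N (config pc r m) (1ℚ + b)
  branch-suc {pc = pc} {r} {m} is-jzero is-suc safe = safe-pred (safe-step eq safe)
    where
    eq : step A p (config pc r m) ≡ just (return (config (suc pc) r m))
    eq rewrite is-jzero | is-suc = refl

  -- The next configuration, if it is determined without a random draw.
  successor : Maybe (Rand Conf) → Maybe Conf
  successor (just (return c)) = just c
  successor _                 = nothing

  -- k deterministic instructions in a row; computes by evaluation on straight-line
  -- code.
  advance : ℕ → Conf → Maybe Conf
  advance zero    c = just c
  advance (suc k) c with successor (step A p c)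
  ... | just c′ = advance k c′
  ... | nothing = nothing

  straight : ∀ {N} k {c c′ b} → advance k c ≡ just c′ → Safe N c′ b → Safe N c (ι k + b)
  straight zero {b = b} refl safe = safe-weaken (≤-reflexive (sym (+-identityˡ b))) safe
  straight (suc k) {c} {b = b} eq safe with step A p c in eq′
  ... | just (return c″) = safe-weaken
    (≤-reflexive (trans (sym (+-assoc 1ℚ (ι k) b)) (cong (_+ b) (sym (ι-suc k)))))
    (safe-pred (safe-step eq′ (straight k eq safe)))

------------------------------------------------------------------------
-- Alternating walks

-- In the following, `next u` is the neighbour chosen when the walk last left the
-- vertex u of P, and `mate v` is the partner of the vertex v of Q.
module _ {n} (next mate : Fin n → Maybe (Fin n)) where

  -- Path u w t: alternately following next and mate leads from u to w in at most
  -- t rounds, and w occurs only at the end.  In particular the path does not use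
  -- the pointer of w.
  data Path : Fin n → Fin n → ℕ → Set where
    here : ∀ {w t} → Path w w t
    via : ∀ {u v u′ w t} → u ≢ w → next u ≡ just v → mate v ≡ just u′ →
           Path u′ w t → Path u w (suc t)

  -- Augmenting u l: following next and mate from u reaches an unmatched vertex of
  -- Q, and the path has exactly l vertices in P.
  data Augmenting : Fin n → ℕ → Set where
    last : ∀ {u v} → next u ≡ just v → mate v ≡ nothing → Augmenting u 1
    via : ∀ {u v u′ l} → next u ≡ just v → mate v ≡ just u′ →
           Augmenting u′ l → Augmenting u (suc l)

  -- If the path already visits u, it is cut there; this erases the loop.
  path-extend : ∀ {s w v u t} → next w ≡ just v → mate v ≡ just u →
                Path s w t → Path s u (suc t)
  path-extend {s} {u = u} w↦v v↦u path with s Fin.≟ u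
  ... | yes refl = here
  path-extend w↦v v↦u here                   | no s≢u = via s≢u w↦v v↦u here
  path-extend w↦v v↦u (via s≢w s↦y y↦x path) | no s≢u =
    via s≢u s↦y y↦x (path-extend w↦v v↦u path)

  path-finish : ∀ {s w v t} → next w ≡ just v → mate v ≡ nothing →
                Path s w t → ∃ λ l → Augmenting s l × l ℕ.≤ suc t
  path-finish w↦v v-free here = 1 , last w↦v v-free , ℕ.s≤s ℕ.z≤n
  path-finish w↦v v-free (via _ s↦y y↦x path) with path-finish w↦v v-free path
  ... | l , aug , l≤ = suc l , via s↦y y↦x aug , ℕ.s≤s l≤

  augmenting⇒next : ∀ {u l} → Augmenting u l → ∃ λ v → next u ≡ just v
  augmenting⇒next (last u↦v _)   = _ , u↦v
  augmenting⇒next (via u↦v _ _) = _ , u↦v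

  -- The path is determined by its first vertex, hence so is its length.
  augmenting-length : ∀ {u l l′} → Augmenting u l → Augmenting u l′ → l ≡ l′
  augmenting-length (last _ _) (last _ _) = refl
  augmenting-length (last p q) (via p′ q′ _) with refl ← trans (sym p) p′
    = contradiction (trans (sym q) q′) (λ ())
  augmenting-length (via p q _) (last p′ q′) with refl ← trans (sym p) p′
    = contradiction (trans (sym q) q′) (λ ())
  augmenting-length (via p q a) (via p′ q′ a′)
    with refl ← trans (sym p) p′ with refl ← trans (sym q) q′
    = cong suc (augmenting-length a a′)

-- A path to w survives a new departure from w.
path-redirect : ∀ {n} {next mate : Fin n → Maybe (Fin n)} {s w t x} →
                Path next mate s w t → Path (next ⟨ w ≔ x ⟩) mate s w t
path-redirect here = here
path-redirect {next = next} (via u≢w u↦v v↦u′ path) =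
  via u≢w (trans (update-other next u≢w) u↦v) v↦u′ (path-redirect path)

-- Changing the mate of v does not affect the augmenting path that starts at the
-- old mate of v: a path returning to v would be longer than itself.
augmenting-rematch : ∀ {n} {next mate : Fin n → Maybe (Fin n)} {v u l x} →
                     mate v ≡ just u → Augmenting next mate u l →
                     Augmenting next (mate ⟨ v ≔ x ⟩) u l
augmenting-rematch {next = next} {mate} {v} {u} {l} {x} v↦u aug = go aug ℕ.≤-refl
  where
  go : ∀ {w j} → Augmenting next mate w j → j ℕ.≤ l → Augmenting next (mate ⟨ v ≔ x ⟩) w j
  go (last {v = y} w↦y y-free) _ = last w↦y (trans (update-other mate y≢v) y-free)
    where
    y≢v : y ≢ v
    y≢v refl = contradiction (trans (sym v↦u) y-free) (λ ())
  go (via {v = y} {l = j} w↦y y↦w′ aug′) 1+j≤l =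
    via w↦y (trans (update-other mate y≢v) y↦w′) (go aug′ (ℕ.<⇒≤ 1+j≤l))
    where
    y≢v : y ≢ v
    y≢v refl with refl ← trans (sym v↦u) y↦w′ =
      ℕ.<⇒≢ 1+j≤l (augmenting-length next mate aug′ aug)

------------------------------------------------------------------------
-- The program

rOne rSize rTwice rDeg rLeft rCur rNbr rStart rAddr rVal : Fin 10
rOne   = 0F
rSize  = 1F
rTwice = 2F
rDeg   = 3F
rLeft  = 4F
rCur   = 5F
rNbr   = 6F
rStart = 7F
rAddr  = 8F
rVal   = 9F

-- For vertices u of P and v of Q, cell u holds the output, cell n + v is 0 if v is
-- unmatched and otherwise one more than its mate, and cell 2n + u is 0 if `next u`
-- is undefined and otherwise one more than it.  Registers and cells start at 0.
program : Program
program = record { registers = 10 ; code =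
    size rSize ∷ add rTwice rSize rSize ∷ const rOne 1 ∷ degree rDeg ∷ size rLeft ∷
    -- Position 5: the loop over the phases; rLeft vertices of P are unmatched.
    jzero rLeft 35 ∷
    -- Position 6: draw s until cell 2n + s is 0.
    rand rStart rSize ∷
    add rAddr rTwice rStart ∷
    load rVal rAddr ∷
    jzero rVal 11 ∷
    jump 6 ∷
    -- Position 11: copy s; rVal is 0 here.
    add rCur rStart rVal ∷
    -- Position 12: one round of the walk, at the vertex rCur.
    rand rAddr rDeg ∷
    nbrP rNbr rCur rAddr ∷
    add rAddr rTwice rCur ∷
    add rVal rOne rNbr ∷
    store rAddr rVal ∷
    add rAddr rSize rNbr ∷
    load rVal rAddr ∷
    jzero rVal 22 ∷
    sub rCur rVal rOne ∷
    jump 12 ∷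
    -- Position 22: match rStart to the vertex its pointer names, and go on from
    -- the previous mate of that vertex.
    add rAddr rTwice rStart ∷
    load rNbr rAddr ∷
    sub rNbr rNbr rOne ∷
    store rStart rNbr ∷
    add rAddr rSize rNbr ∷
    load rVal rAddr ∷
    add rCur rOne rStart ∷
    store rAddr rCur ∷
    jzero rVal 33 ∷
    sub rStart rVal rOne ∷
    jump 22 ∷
    -- Position 33: the matching has grown by one edge.
    sub rLeft rLeft rOne ∷
    jump 5 ∷
    halt ∷ [] }

-- The representation of an optional vertex in a memory cell.
encode : ∀ {n} → Maybe (Fin n) → ℕ
encode = maybe′ (suc ∘ toℕ) 0

entry-toℕ : ∀ {n d m} (a : Fin n → Fin d → Fin m) u i → entry a (toℕ u) (toℕ i) ≡ toℕ (a u i)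
entry-toℕ {n} {d} a u i with toℕ u ℕ.<? n | toℕ i ℕ.<? d
... | yes u<n | yes i<d = cong toℕ (cong₂ a (fromℕ<-toℕ u u<n) (fromℕ<-toℕ i i<d))
... | yes _   | no  i≮d = contradiction (toℕ<n i) i≮d
... | no  u≮n | _       = contradiction (toℕ<n u) u≮n

------------------------------------------------------------------------
-- States of the memory

module Algorithm {n₁ d₁} {G : BipartiteGraph (suc n₁) (suc n₁)} (regular : Regular (suc d₁) G)
                 {A : AdjacencyArrays (suc n₁) (suc d₁)} (represents : Represents A G) where

  private
    n d : ℕ
    n = suc n₁
    d = suc d₁

  open BipartiteGraph G
  open AdjacencyArrays A
  open Represents represents

  -- The memory m stores mate and next; mate is a matching, and pointers run along
  -- edges.  The output cell of an unmatched vertex is unconstrained.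
  record Valid (m : ℕ → ℕ) (mate next : Fin n → Maybe (Fin n)) : Set where
    field
      mate-at   : ∀ v → m (n ℕ.+ toℕ v) ≡ encode (mate v)
      next-at   : ∀ u → m (n ℕ.+ n ℕ.+ toℕ u) ≡ encode (next u)
      out-at    : ∀ {v u} → mate v ≡ just u → m (toℕ u) ≡ toℕ v
      mate-edge : ∀ {v u} → mate v ≡ just u → Edge u v
      next-edge : ∀ {u v} → next u ≡ just v → Edge u v
      injective : InjectiveWhereDefined mate

  -- The three blocks of memory cells are disjoint.
  out≢mate : ∀ {u v : Fin n} → toℕ u ≢ n ℕ.+ toℕ v
  out≢mate {u} {v} eq = ℕ.<⇒≢ (ℕ.<-≤-trans (toℕ<n u) (ℕ.m≤m+n n (toℕ v))) eq

  out≢next : ∀ {u w : Fin n} → toℕ u ≢ n ℕ.+ n ℕ.+ toℕ w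
  out≢next {u} {w} eq =
    ℕ.<⇒≢ (ℕ.<-≤-trans (toℕ<n u) (ℕ.m≤m+n n (n ℕ.+ toℕ w))) (trans eq (ℕ.+-assoc n n (toℕ w)))

  mate≢next : ∀ {v w : Fin n} → n ℕ.+ toℕ v ≢ n ℕ.+ n ℕ.+ toℕ w
  mate≢next {v} {w} eq =
    out≢mate {v} {w} (ℕ.+-cancelˡ-≡ n _ _ (trans eq (ℕ.+-assoc n n (toℕ w))))

  offset-≢ : ∀ k {i j : Fin n} → i ≢ j → k ℕ.+ toℕ i ≢ k ℕ.+ toℕ j
  offset-≢ k i≢j eq = i≢j (toℕ-injective (ℕ.+-cancelˡ-≡ k _ _ eq))

  -- Storing a pointer, as done in each round of the walk.
  valid-redirect : ∀ {m mate next} u {v} → Edge u v → Valid m mate next →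
                   Valid (m [ n ℕ.+ n ℕ.+ toℕ u ↦ suc (toℕ v) ]) mate (next ⟨ u ≔ just v ⟩)
  valid-redirect {m} {mate} {next} u {v} u-v valid = record
    { mate-at   = λ y → trans (write-other m (mate≢next {y} {u})) (mate-at y)
    ; next-at   = next-at′
    ; out-at    = λ {_} {w} y↦w → trans (write-other m (out≢next {w} {u})) (out-at y↦w)
    ; mate-edge = mate-edge
    ; next-edge = next-edge′
    ; injective = injective
    }
    where
    open Valid valid
    next-at′ : ∀ w → (m [ n ℕ.+ n ℕ.+ toℕ u ↦ suc (toℕ v) ]) (n ℕ.+ n ℕ.+ toℕ w)
                     ≡ encode ((next ⟨ u ≔ just v ⟩) w)
    next-at′ w with w Fin.≟ u
    ... | yes refl = trans (write-same m (n ℕ.+ n ℕ.+ toℕ u)) (cong encode (sym (update-same next u)))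
    ... | no  w≢u  = trans (write-other m (offset-≢ (n ℕ.+ n) w≢u))
                       (trans (next-at w) (cong encode (sym (update-other next w≢u))))
    next-edge′ : ∀ {w y} → (next ⟨ u ≔ just v ⟩) w ≡ just y → Edge w y
    next-edge′ eq with update-inv next u eq
    ... | inj₁ (refl , refl) = u-v
    ... | inj₂ (_ , w↦y)     = next-edge w↦y

  -- Matching an unmatched u to v; a previous mate of v becomes unmatched.
  valid-rematch : ∀ {m mate next} u v → Edge u v → (∀ y → mate y ≢ just u) → Valid m mate next →
                  Valid (m [ toℕ u ↦ toℕ v ] [ n ℕ.+ toℕ v ↦ suc (toℕ u) ]) (mate ⟨ v ≔ just u ⟩) next
  valid-rematch {m} {mate} {next} u v u-v unmatched valid = record
    { mate-at   = mate-at′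
    ; next-at   = λ w → trans (write-other m₁ (mate≢next {v} {w} ∘ sym))
                          (trans (write-other m (out≢next {u} {w} ∘ sym)) (next-at w))
    ; out-at    = out-at′
    ; mate-edge = mate-edge′
    ; next-edge = next-edge
    ; injective = injective′
    }
    where
    open Valid valid
    m₁ = m [ toℕ u ↦ toℕ v ]
    mate-at′ : ∀ y → (m₁ [ n ℕ.+ toℕ v ↦ suc (toℕ u) ]) (n ℕ.+ toℕ y) ≡ encode ((mate ⟨ v ≔ just u ⟩) y)
    mate-at′ y with y Fin.≟ v
    ... | yes refl = trans (write-same m₁ (n ℕ.+ toℕ v)) (cong encode (sym (update-same mate v)))
    ... | no  y≢v  = trans (write-other m₁ (offset-≢ n y≢v)) (trans (write-other m (out≢mate {u} {y} ∘ sym))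
                       (trans (mate-at y) (cong encode (sym (update-other mate y≢v)))))
    out-at′ : ∀ {y w} → (mate ⟨ v ≔ just u ⟩) y ≡ just w →
              (m₁ [ n ℕ.+ toℕ v ↦ suc (toℕ u) ]) (toℕ w) ≡ toℕ y
    out-at′ {y} {w} eq = trans (write-other m₁ (out≢mate {w} {v})) (out-at₁ (update-inv mate v eq))
      where
      out-at₁ : (y ≡ v × just u ≡ just w) ⊎ (y ≢ v × mate y ≡ just w) → m₁ (toℕ w) ≡ toℕ y
      out-at₁ (inj₁ (refl , refl)) = write-same m (toℕ u)
      out-at₁ (inj₂ (_ , y↦w)) = trans
        (write-other m (λ eq′ → unmatched y (trans y↦w (cong just (toℕ-injective eq′))))) (out-at y↦w)
    mate-edge′ : ∀ {y w} → (mate ⟨ v ≔ just u ⟩) y ≡ just w → Edge w y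
    mate-edge′ eq with update-inv mate v eq
    ... | inj₁ (refl , refl) = u-v
    ... | inj₂ (_ , y↦w)     = mate-edge y↦w
    injective′ : InjectiveWhereDefined (mate ⟨ v ≔ just u ⟩)
    injective′ {y} {y′} p q with update-inv mate v p | update-inv mate v q
    ... | inj₁ (refl , _)    | inj₁ (refl , _)    = refl
    ... | inj₁ (_ , refl)    | inj₂ (_ , y′↦u)    = contradiction y′↦u (unmatched y′)
    ... | inj₂ (_ , y↦u)     | inj₁ (_ , refl)    = contradiction y↦u (unmatched y)
    ... | inj₂ (_ , y↦w)     | inj₂ (_ , y′↦w)    = injective y↦w y′↦w

  -- Between phases: free is the set of unmatched vertices of P, and these are the
  -- vertices without a pointer.
  record Idle (m : ℕ → ℕ) (mate next : Fin n → Maybe (Fin n)) (free : Fin n → Bool) (k : ℕ) : Set where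
    field
      valid     : Valid m mate next
      free-next : ∀ u → free u ≡ is-nothing (next u)
      matched   : ∀ u → free u ≡ false → ∃ λ v → mate v ≡ just u
      mate-busy : ∀ {v u} → mate v ≡ just u → free u ≡ false
      count     : card free ≡ k

  -- While the matching is switched: s is the one vertex of P outside free that
  -- has no mate.
  record Shifting (m : ℕ → ℕ) (mate next : Fin n → Maybe (Fin n)) (free : Fin n → Bool) (k : ℕ)
                  (s : Fin n) : Set where
    field
      valid     : Valid m mate next
      free-next : ∀ u → free u ≡ is-nothing (next u)
      matched   : ∀ u → u ≢ s → free u ≡ false → ∃ λ v → mate v ≡ just u
      mate-busy : ∀ {v u} → mate v ≡ just u → free u ≡ false
      busy      : free s ≡ false
      unmatched : ∀ v → mate v ≢ just s
      count     : card free ≡ k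

  rematch-busy : ∀ {mate : Fin n → Maybe (Fin n)} {free : Fin n → Bool} {v s} → free s ≡ false →
                 (∀ {y u} → mate y ≡ just u → free u ≡ false) →
                 ∀ {y u} → (mate ⟨ v ≔ just s ⟩) y ≡ just u → free u ≡ false
  rematch-busy {mate} {v = v} busy mate-busy eq with update-inv mate v eq
  ... | inj₁ (_ , refl) = busy
  ... | inj₂ (_ , y↦u)  = mate-busy y↦u

  shift-last : ∀ {m mate next free k s v} → Shifting m mate next free k s →
               next s ≡ just v → mate v ≡ nothing →
               Idle (m [ toℕ s ↦ toℕ v ] [ n ℕ.+ toℕ v ↦ suc (toℕ s) ]) (mate ⟨ v ≔ just s ⟩) next free k
  shift-last {mate = mate} {free = free} {s = s} {v} shifting s↦v v-free = record
    { valid     = valid-rematch s v (Valid.next-edge valid s↦v) unmatched valid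
    ; free-next = free-next
    ; matched   = matched′
    ; mate-busy = λ {y} → rematch-busy {mate} {v = v} busy mate-busy {y}
    ; count     = count
    }
    where
    open Shifting shifting
    matched′ : ∀ u → free u ≡ false → ∃ λ y → (mate ⟨ v ≔ just s ⟩) y ≡ just u
    matched′ u u-busy with u Fin.≟ s
    ... | yes refl = v , update-same mate v
    ... | no  u≢s  with y , y↦u ← matched u u≢s u-busy =
      y , trans (update-other mate {i = v} (λ { refl → contradiction (trans (sym v-free) y↦u) (λ ()) })) y↦u

  shift-step : ∀ {m mate next free k s v s′} → Shifting m mate next free k s →
               next s ≡ just v → mate v ≡ just s′ →
               Shifting (m [ toℕ s ↦ toℕ v ] [ n ℕ.+ toℕ v ↦ suc (toℕ s) ]) (mate ⟨ v ≔ just s ⟩) next free k s′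
  shift-step {mate = mate} {free = free} {s = s} {v} {s′} shifting s↦v v↦s′ = record
    { valid     = valid-rematch s v (Valid.next-edge valid s↦v) unmatched valid
    ; free-next = free-next
    ; matched   = matched′
    ; mate-busy = λ {y} → rematch-busy {mate} {v = v} busy mate-busy {y}
    ; busy      = mate-busy v↦s′
    ; unmatched = unmatched′
    ; count     = count
    }
    where
    open Shifting shifting
    matched′ : ∀ u → u ≢ s′ → free u ≡ false → ∃ λ y → (mate ⟨ v ≔ just s ⟩) y ≡ just u
    matched′ u u≢s′ u-busy with u Fin.≟ s
    ... | yes refl = v , update-same mate v
    ... | no  u≢s  with y , y↦u ← matched u u≢s u-busy =
      y , trans (update-other mate {i = v} (λ { refl → u≢s′ (just-injective (trans (sym y↦u) v↦s′)) })) y↦u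
    unmatched′ : ∀ y → (mate ⟨ v ≔ just s ⟩) y ≢ just s′
    unmatched′ y eq with update-inv mate v eq
    ... | inj₁ (_ , refl)     = unmatched v v↦s′
    ... | inj₂ (y≢v , y↦s′)   = y≢v (Valid.injective valid y↦s′ v↦s′)

  -- During a walk that started at s and is at u after t rounds.  The matching and
  -- free stay as they were before the walk, and s is the only vertex of free that
  -- may have a pointer.
  record Walking (m : ℕ → ℕ) (mate next : Fin n → Maybe (Fin n)) (free : Fin n → Bool)
                 (s u : Fin n) (t : ℕ) : Set where
    field
      valid     : Valid m mate next
      next-free : ∀ w → w ≢ s → free w ≡ is-nothing (next w)
      position  : u ≡ s ⊎ free u ≡ false
      path      : Path next mate s u t

  walk-start : ∀ {m mate next free k s} → Idle m mate next free k → Walking m mate next free s s 0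
  walk-start idle = record
    { valid = valid ; next-free = λ w _ → free-next w ; position = inj₁ refl ; path = here }
    where open Idle idle

  walk-redirect : ∀ {m mate next free s u t v} → Edge u v → Walking m mate next free s u t →
                  Walking (m [ n ℕ.+ n ℕ.+ toℕ u ↦ suc (toℕ v) ]) mate (next ⟨ u ≔ just v ⟩) free s u t
  walk-redirect {next = next} {free} {s} {u} {v = v} u-v walking = record
    { valid     = valid-redirect u u-v valid
    ; next-free = next-free′
    ; position  = position
    ; path      = path-redirect path
    }
    where
    open Walking walking
    next-free′ : ∀ w → w ≢ s → free w ≡ is-nothing ((next ⟨ u ≔ just v ⟩) w)
    next-free′ w w≢s with w Fin.≟ u
    ... | no w≢u = trans (next-free w w≢s) (cong is-nothing (sym (update-other next w≢u)))
    next-free′ w w≢s | yes refl with position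
    ... | inj₁ u≡s    = contradiction u≡s w≢s
    ... | inj₂ u-busy = trans u-busy (cong is-nothing (sym (update-same next u)))

  walk-step : ∀ {m mate next free s u u′ t v} → Walking m mate next free s u t →
              next u ≡ just v → mate v ≡ just u′ → free u′ ≡ false →
              Walking m mate next free s u′ (suc t)
  walk-step {mate = mate} {next} walking u↦v v↦u′ u′-busy = record
    { valid     = valid
    ; next-free = next-free
    ; position  = inj₂ u′-busy
    ; path      = path-extend next mate u↦v v↦u′ path
    }
    where open Walking walking

  -- At an unmatched v the pointers form an augmenting path from s, and s leaves
  -- the set of free vertices.
  walk-finish : ∀ {m m₀ mate next next₀ free s u t v k} → Idle m₀ mate next₀ free (suc k) → free s ≡ true →
                Walking m mate next free s u t → next u ≡ just v → mate v ≡ nothing →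
                ∃ λ l → l ℕ.≤ suc t × Augmenting next mate s l
                        × Shifting m mate next (free ⟨ s ≔ false ⟩) k s
  walk-finish {mate = mate} {next} {free = free} {s = s} {k = k} idle s-free walking u↦v v-free
    with l , aug , l≤1+t ← path-finish next mate u↦v v-free (Walking.path walking) =
    l , l≤1+t , aug , record
    { valid     = valid
    ; free-next = free-next′
    ; matched   = λ w w≢s w-busy → matched w (trans (sym (update-other free w≢s)) w-busy)
    ; mate-busy = mate-busy′
    ; busy      = update-same free s
    ; unmatched = λ y y↦s → contradiction (trans (sym s-free) (mate-busy y↦s)) (λ ())
    ; count     = ℕ.suc-injective (trans (sym (card-delete free s s-free)) count)
    }
    where
    open Idle idle using (matched; mate-busy; count)
    open Walking walking
    free-next′ : ∀ w → (free ⟨ s ≔ false ⟩) w ≡ is-nothing (next w)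
    free-next′ w with w Fin.≟ s
    ... | yes refl = trans (update-same free s) (cong is-nothing (sym (proj₂ (augmenting⇒next next mate aug))))
    ... | no  w≢s  = trans (update-other free w≢s) (next-free w w≢s)
    mate-busy′ : ∀ {y w} → mate y ≡ just w → (free ⟨ s ≔ false ⟩) w ≡ false
    mate-busy′ {w = w} y↦w with w Fin.≟ s
    ... | yes refl = update-same free s
    ... | no  w≢s  = trans (update-other free w≢s) (mate-busy y↦w)

  idle⇒perfect : ∀ {m mate next free} → Idle m mate next free 0 →
                 PerfectMatching G (λ u v → m (toℕ u) ≡ toℕ v)
  idle⇒perfect {m} {mate} {free = free} idle = record
    { edges  = λ {u} {v} eq → subst (Edge u) (partner-unique eq) (mate-edge (partner-mate u))
    ; coverP = λ u → partner u , partner-out u , partner-unique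
    ; coverQ = coverQ
    }
    where
    open Idle idle
    open Valid valid
    partner : Fin n → Fin n
    partner u = proj₁ (matched u (card≡0⇒empty free count u))
    partner-mate : ∀ u → mate (partner u) ≡ just u
    partner-mate u = proj₂ (matched u (card≡0⇒empty free count u))
    partner-out : ∀ u → m (toℕ u) ≡ toℕ (partner u)
    partner-out u = out-at (partner-mate u)
    partner-unique : ∀ {u v} → m (toℕ u) ≡ toℕ v → partner u ≡ v
    partner-unique {u} eq = toℕ-injective (trans (sym (partner-out u)) eq)
    partner-injective : Injective _≡_ _≡_ partner
    partner-injective {u} {w} eq =
      just-injective (trans (sym (partner-mate u)) (trans (cong mate eq) (partner-mate w)))
    coverQ : ∀ v → ∃! _≡_ λ u → m (toℕ u) ≡ toℕ v
    coverQ v with u , eq ← injective⇒surjective partner-injective v =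
      u , trans (partner-out u) (cong toℕ eq) , λ eq′ → partner-injective (trans eq (sym (partner-unique eq′)))

  ----------------------------------------------------------------------
  -- Running time

  open Machine A program (λ c → PerfectMatching G (output A program c))

  -- A configuration inside the loops, where the first four registers keep their
  -- initial contents.
  at : ℕ → (k u v s a x : ℕ) → (ℕ → ℕ) → Conf
  at pc k u v s a x m = config pc (1 ∷ n ∷ n ℕ.+ n ∷ d ∷ k ∷ u ∷ v ∷ s ∷ a ∷ x ∷ []) m

  -- Bounds on the remaining time, with k vertices of P unmatched, when a vertex
  -- is about to be drawn and at the head of the loop over the phases.  With k
  -- unmatched vertices a draw costs at most 5 instructions and is repeated n/k
  -- times on average; a round of the walk, together with the switching of its
  -- edge later on, costs at most 10 + 11 instructions.  This gives 26 n/k per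
  -- phase, and the test at the head of the loop adds one.
  sampleBound phasesBound : ℕ → ℚ
  sampleBound k = ι k + ι (26 * n) · H k
  phasesBound k = 1ℚ + sampleBound k

  0≤sampleBound : ∀ k → 0ℚ ≤ sampleBound k
  0≤sampleBound k = 0≤+ (0≤ι k) (0≤· (0≤ι (26 * n)) (0≤H k))

  sampleBound-suc : ∀ k → sampleBound (suc k) ≡ phasesBound k + ι (26 * n) · inv k
  sampleBound-suc k = trans (cong (_+ ι (26 * n) · H (suc k)) (ι-suc k))
    (solve 4 (λ i c h v → con 1ℚ :+ i :+ c :* (h :+ v) := con 1ℚ :+ (i :+ c :* h) :+ c :* v) refl
      (ι k) (ι (26 * n)) (H k) (inv k))
    where open +-*-Solver

  -- A phase that starts with suc k unmatched vertices, given that the remaining k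
  -- phases are safe.
  module Phase (k : ℕ) (next-phase : ∀ {m mate next free} → Idle m mate next free k →
                        ∀ N {u v s a x} → Safe N (at 5 k u v s a x m) (phasesBound k)) where

    augment-segment : ∀ {N m b u v₀ a x s v y} → m (n ℕ.+ n ℕ.+ s) ≡ suc v → (m [ s ↦ v ]) (n ℕ.+ v) ≡ y →
      Safe N (at 30 (suc k) (suc s) v s (n ℕ.+ v) y (m [ s ↦ v ] [ n ℕ.+ v ↦ suc s ])) b →
      Safe N (at 22 (suc k) u v₀ s a x m) (ι 8 + b)
    augment-segment {m = m} {s = s} {v} {y} eq₁ eq₂ = straight 8 (trans
      (cong (λ z → let w = z ℕ.∸ 1; m′ = m [ s ↦ w ] in
                   just (at 30 (suc k) (suc s) w s (n ℕ.+ w) (m′ (n ℕ.+ w)) (m′ [ n ℕ.+ w ↦ suc s ]))) eq₁)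
      (cong (λ z → just (at 30 (suc k) (suc s) v s (n ℕ.+ v) z (m [ s ↦ v ] [ n ℕ.+ v ↦ suc s ]))) eq₂))

    -- Each of the l rounds takes 11 instructions, except that the last one takes 9
    -- and two more to return to the head of the outer loop.
    safe-augment : ∀ N {l m mate next free s} → Augmenting next mate s l →
                   Shifting m mate next free k s → ∀ {u v a x} →
                   Safe N (at 22 (suc k) u v (toℕ s) a x m) (ι (l * 11) + phasesBound k)
    safe-augment N {m = m} {s = s} (last {v = v} s↦v v-free) shifting = safe-weaken
      (≤-reflexive (solve 1 (λ f → con (ι 8) :+ (con 1ℚ :+ (con (ι 2) :+ f)) := con (ι 11) :+ f) refl (phasesBound k)))
      (augment-segment {m = m} (trans (next-at s) (cong encode s↦v))
        (trans (write-other m (out≢mate {s} {v} ∘ sym)) (trans (mate-at v) (cong encode v-free)))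
        (branch-zero refl refl (straight 2 refl (next-phase (shift-last shifting s↦v v-free) N))))
      where
      open +-*-Solver
      open Valid (Shifting.valid shifting)
    safe-augment N {l = suc l} {m = m} {s = s} (via {v = v} s↦v v↦s′ aug) shifting = safe-weaken
      (≤-reflexive (trans
        (solve 2 (λ f l → con (ι 8) :+ (con 1ℚ :+ (con (ι 2) :+ (l :+ f))) := con (ι 11) :+ l :+ f) refl
          (phasesBound k) (ι (l * 11)))
        (cong (_+ phasesBound k) (sym (ι-+ 11 (l * 11))))))
      (augment-segment {m = m} (trans (next-at s) (cong encode s↦v))
        (trans (write-other m (out≢mate {s} {v} ∘ sym)) (trans (mate-at v) (cong encode v↦s′)))
        (branch-suc refl refl (straight 2 refl
          (safe-augment N (augmenting-rematch v↦s′ aug) (shift-step shifting s↦v v↦s′)))))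
      where
      open +-*-Solver
      open Valid (Shifting.valid shifting)

    module _ {mate : Fin n → Maybe (Fin n)} {free : Fin n → Bool} {m₀ next₀}
             (idle : Idle m₀ mate next₀ free (suc k)) where
      open Walk arrayP mate

      walk-segment : ∀ {N m b u v₀ s i x₀ v x} → entry arrayP u i ≡ v →
        (m [ n ℕ.+ n ℕ.+ u ↦ suc v ]) (n ℕ.+ v) ≡ x →
        Safe N (at 19 (suc k) u v s (n ℕ.+ v) x (m [ n ℕ.+ n ℕ.+ u ↦ suc v ])) b →
        Safe N (at 13 (suc k) u v₀ s i x₀ m) (ι 6 + b)
      walk-segment {m = m} {u = u} {s = s} eq₁ eq₂ = straight 6 (trans
        (cong (λ z → let m′ = m [ n ℕ.+ n ℕ.+ u ↦ suc z ] in
                     just (at 19 (suc k) u z s (n ℕ.+ z) (m′ (n ℕ.+ z)) m′)) eq₁)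
        (cong (λ x → just (at 19 (suc k) u _ s (n ℕ.+ _) x (m [ n ℕ.+ n ℕ.+ u ↦ suc _ ]))) eq₂))

      -- The rest of the walk at 21 per round, and 11 for each of the t rounds already
      -- made, since their edges may have to be switched.
      walkBound : ℕ → Fin n → ℕ → ℚ
      walkBound N u t = ι 21 · walkTime N u + (ι (t * 11) + phasesBound k)

      safe-walk : ∀ N {m next s u t} → free s ≡ true → Walking m mate next free s u t → ∀ {v a x} →
                  Safe N (at 12 (suc k) (toℕ u) v (toℕ s) a x m) (walkBound N u t)
      safe-walk zero {u = u} {t} s-free walking = safe-zero refl
        (0≤+ (0≤· (0≤ι 21) ≤-refl) (0≤+ (0≤ι (t * 11)) (0≤+ 0≤1 (0≤sampleBound k))))
      safe-walk (suc N) {m} {next} {s} {u} {t} s-free walking = safe-weaken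
        (≤-reflexive (trans
          (cong (_+_ 1ℚ) (avg-affine (ι 21) (ι 20 + rest) (λ i → onward N (arrayP u i))))
          (solve 2 (λ r a → con 1ℚ :+ (con (ι 20) :+ r :+ con (ι 21) :* a) := con (ι 21) :* (con 1ℚ :+ a) :+ r) refl
            rest (avg d₁ (λ i → onward N (arrayP u i))))))
        (safe-draw refl (λ i → after-draw i))
        where
        open +-*-Solver
        rest = ι (t * 11) + phasesBound k
        -- The draw itself leaves 20 of the 21 units for this round.
        after-draw : ∀ i {v x} → Safe N (at 13 (suc k) (toℕ u) v (toℕ s) (toℕ i) x m)
          (ι 20 + rest + ι 21 · onward N (arrayP u i))
        after-draw i = go (mate v) refl
          where
          v = arrayP u i
          walking′ = walk-redirect (Equivalence.from (listsP u v) (i , refl)) walking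
          open Valid (Walking.valid walking′)
          u↦v = update-same next u
          open ≤-Reasoning
          go : ∀ mv → mate v ≡ mv → ∀ {v₀ x} → Safe N (at 13 (suc k) (toℕ u) v₀ (toℕ s) (toℕ i) x m)
            (ι 20 + rest + ι 21 · maybe′ (walkTime N) 0ℚ mv)
          go nothing v-free with l , l≤1+t , aug , shifting ← walk-finish idle s-free walking′ u↦v v-free =
            safe-weaken (begin
                ι 6 + (1ℚ + (ι (l * 11) + phasesBound k))
                  ≤⟨ +-monoʳ-≤ (ι 6) (+-monoʳ-≤ 1ℚ (+-monoˡ-≤ (phasesBound k) (ι-mono {l * 11} {13 ℕ.+ t * 11}
                       (ℕ.≤-trans (ℕ.*-monoˡ-≤ 11 l≤1+t) (ℕ.m≤n+m (11 ℕ.+ t * 11) 2))))) ⟩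
                ι 6 + (1ℚ + (ι (13 ℕ.+ t * 11) + phasesBound k))
                  ≡⟨ cong (λ z → ι 6 + (1ℚ + (z + phasesBound k))) (ι-+ 13 (t * 11)) ⟩
                ι 6 + (1ℚ + (ι 13 + ι (t * 11) + phasesBound k))
                  ≡⟨ solve 2 (λ x f → con (ι 6) :+ (con 1ℚ :+ (con (ι 13) :+ x :+ f))
                       := con (ι 20) :+ (x :+ f) :+ con (ι 21) :* con 0ℚ) refl (ι (t * 11)) (phasesBound k) ⟩
                ι 20 + rest + ι 21 · 0ℚ ∎)
              (walk-segment (entry-toℕ arrayP u i) (trans (mate-at v) (cong encode v-free))
                (branch-zero refl refl (safe-augment N aug shifting)))
          go (just u′) v↦u′ = safe-weaken (≤-reflexive (trans
              (cong (λ z → ι 6 + (1ℚ + (ι 2 + (ι 21 · walkTime N u′ + (z + phasesBound k))))) (ι-+ 11 (t * 11)))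
              (solve 3 (λ h x f → con (ι 6) :+ (con 1ℚ :+ (con (ι 2) :+ (con (ι 21) :* h :+ (con (ι 11) :+ x :+ f))))
                 := con (ι 20) :+ (x :+ f) :+ con (ι 21) :* h) refl (walkTime N u′) (ι (t * 11)) (phasesBound k))))
            (walk-segment (entry-toℕ arrayP u i) (trans (mate-at v) (cong encode v↦u′))
              (branch-suc refl refl (straight 2 refl (safe-walk N s-free
                (walk-step walking′ u↦v v↦u′ (Idle.mate-busy idle v↦u′))))))

    -- The average over the draw: each unmatched s saves 26 n/(k+1) compared
    -- with drawing again, at the price of its walk.  Over the suc k unmatched
    -- vertices this saves 26 n, and the walks cost at most 21 n in total; the
    -- remaining 5 n pay for the draw itself.
    sample-bound : ∀ {free : Fin n → Bool} {τ : Fin n → ℚ} → card free ≡ suc k →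
      sum (λ s → free s ⊙ τ s) ≤ ι n →
      1ℚ + avg n₁ (λ s → ι 4 + (if free s then ι 21 · τ s + phasesBound k else sampleBound (suc k))) ≤ sampleBound (suc k)
    sample-bound {free} {τ} count short = +avg-≤ {n₁} {λ s → ι 4 + X s} 1ℚ (+-cancelʳ-≤ (ι 21 · ι n) (begin
      ι n · 1ℚ + sum (λ s → ι 4 + X s) + ι 21 · ι n
        ≡⟨ cong (λ z → ι n · 1ℚ + z + ι 21 · ι n) (trans (∑-distrib-+ (λ _ → ι 4) X) (cong (_+ sum X) (sum-const n (ι 4)))) ⟩
      ι n · 1ℚ + (ι n · ι 4 + sum X) + ι 21 · ι n
        ≡⟨ solve 2 (λ i x → i :* con 1ℚ :+ (i :* con (ι 4) :+ x) :+ con (ι 21) :* i := x :+ con (ι 26) :* i) refl (ι n) (sum X) ⟩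
      sum X + ι 26 · ι n
        ≡⟨ cong (_+_ (sum X)) total-Δ ⟨
      sum X + sum (λ s → free s ⊙ Δ)
        ≡⟨ ∑-distrib-+ X (λ s → free s ⊙ Δ) ⟨
      sum (λ s → X s + free s ⊙ Δ)
        ≡⟨ sum-cong-≗ exchange ⟩
      sum (λ s → sampleBound (suc k) + ι 21 · (free s ⊙ τ s))
        ≡⟨ ∑-distrib-+ (λ _ → sampleBound (suc k)) (λ s → ι 21 · (free s ⊙ τ s)) ⟩
      sum {n} (λ _ → sampleBound (suc k)) + sum (λ s → ι 21 · (free s ⊙ τ s))
        ≡⟨ cong₂ _+_ (sum-const n (sampleBound (suc k))) (sym (*-distribˡ-sum (ι 21) (λ s → free s ⊙ τ s))) ⟩
      ι n · sampleBound (suc k) + ι 21 · sum (λ s → free s ⊙ τ s)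
        ≤⟨ +-monoʳ-≤ (ι n · sampleBound (suc k)) (·-monoʳ-≤ (0≤ι 21) short) ⟩
      ι n · sampleBound (suc k) + ι 21 · ι n ∎))
      where
      open ≤-Reasoning
      open +-*-Solver
      X : Fin n → ℚ
      X s = if free s then ι 21 · τ s + phasesBound k else sampleBound (suc k)
      -- The saving 26 n/(k+1), as suc k vertices are unmatched.
      Δ = ι (26 * n) · inv k
      total-Δ : sum (λ s → free s ⊙ Δ) ≡ ι 26 · ι n
      total-Δ = begin-equality
        sum (λ s → free s ⊙ Δ)             ≡⟨ sum-⊙-const free Δ ⟩
        ι (card free) · Δ                  ≡⟨ cong (λ j → ι j · Δ) count ⟩
        ι (suc k) · (ι (26 * n) · inv k)
          ≡⟨ solve 3 (λ a b c → a :* (b :* c) := c :* (a :* b)) refl (ι (suc k)) (ι (26 * n)) (inv k) ⟩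
        inv k · (ι (suc k) · ι (26 * n))   ≡⟨ inv-cancel k (ι (26 * n)) ⟩
        ι (26 * n)                         ≡⟨ ι-* 26 n ⟩
        ι 26 · ι n                         ∎
      exchange : ∀ s → X s + free s ⊙ Δ ≡ sampleBound (suc k) + ι 21 · (free s ⊙ τ s)
      exchange s with free s
      ... | true  = trans (solve 3 (λ x f δ → x :+ f :+ δ := f :+ δ :+ x) refl (ι 21 · τ s) (phasesBound k) Δ)
                          (cong (_+ ι 21 · τ s) (sym (sampleBound-suc k)))
      ... | false = cong (_+_ (sampleBound (suc k))) (sym (*-zeroʳ (ι 21)))

    safe-sample : ∀ N {m mate next free} → Idle m mate next free (suc k) → ∀ {u v s a x} →
                  Safe N (at 6 (suc k) u v s a x m) (sampleBound (suc k))
    safe-sample zero idle = safe-zero refl (0≤sampleBound (suc k))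
    safe-sample (suc N) {m} {mate} {next} {free} idle {u} {v} = safe-weaken
      (sample-bound {free} {walkTime N} count (sum-free-walkTime (arrays-balanced regular represents) injective free mate-busy N))
      (safe-draw refl (λ s → after-draw s))
      where
      open +-*-Solver
      open Idle idle
      open Valid valid
      open Walk arrayP mate using (walkTime; sum-free-walkTime)
      -- The time left once s is drawn, depending on whether s is unmatched.
      X : Fin n → Bool → ℚ
      X s b = ι 4 + (if b then ι 21 · walkTime N s + phasesBound k else sampleBound (suc k))
      after-draw : ∀ s {a x} → Safe N (at 7 (suc k) u v (toℕ s) a x m) (X s (free s))
      after-draw s = go (next s) refl
        where
        go : ∀ w → next s ≡ w → ∀ {a x} → Safe N (at 7 (suc k) u v (toℕ s) a x m) (X s (free s))
        go nothing eq = safe-weaken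
          (≤-reflexive (trans
            (solve 2 (λ h f → con (ι 2) :+ (con 1ℚ :+ (con (ι 1) :+ (h :+ (con 0ℚ :+ f)))) := con (ι 4) :+ (h :+ f)) refl
              (ι 21 · walkTime N s) (phasesBound k))
            (cong (X s) (sym s-free))))
          (straight 2 refl (branch-zero refl val≡0
            (straight 1 (cong (λ z → just (at 12 (suc k) z v (toℕ s) (n ℕ.+ n ℕ.+ toℕ s) (m (n ℕ.+ n ℕ.+ toℕ s)) m)) cur≡s)
              (safe-walk idle N s-free (walk-start idle)))))
          where
          s-free : free s ≡ true
          s-free = trans (free-next s) (cong is-nothing eq)
          val≡0 : m (n ℕ.+ n ℕ.+ toℕ s) ≡ 0
          val≡0 = trans (next-at s) (cong encode eq)
          cur≡s : toℕ s ℕ.+ m (n ℕ.+ n ℕ.+ toℕ s) ≡ toℕ s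
          cur≡s = trans (cong (toℕ s ℕ.+_) val≡0) (ℕ.+-identityʳ (toℕ s))
        go (just w) eq = safe-weaken
          (≤-reflexive (trans
            (solve 1 (λ z → con (ι 2) :+ (con 1ℚ :+ (con (ι 1) :+ z)) := con (ι 4) :+ z) refl (sampleBound (suc k)))
            (cong (X s) (sym (trans (free-next s) (cong is-nothing eq))))))
          (straight 2 refl (branch-suc refl (trans (next-at s) (cong encode eq))
            (straight 1 refl (safe-sample N idle))))

  safe-phases : ∀ k {m mate next free} → Idle m mate next free k →
                ∀ N {u v s a x} → Safe N (at 5 k u v s a x m) (phasesBound k)
  safe-phases zero    idle N = safe-weaken (+-monoʳ-≤ 1ℚ (0≤sampleBound 0))
    (branch-zero refl refl (safe-halt refl (idle⇒perfect idle)))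
  safe-phases (suc k) idle N = branch-suc refl refl (Phase.safe-sample k (safe-phases k) N idle)

  idle-initial : Idle (λ _ → 0) (λ _ → nothing) (λ _ → nothing) (λ _ → true) n
  idle-initial = record
    { valid     = record
      { mate-at = λ _ → refl ; next-at = λ _ → refl ; out-at = λ () ; mate-edge = λ ()
      ; next-edge = λ () ; injective = λ () }
    ; free-next = λ _ → refl ; matched = λ _ () ; mate-busy = λ () ; count = card-full n }

  safe-initial : ∀ N → Safe N (initial A program) (ι 5 + phasesBound n)
  safe-initial N = straight 5 refl (safe-phases n idle-initial N)

  -- 26 n H n dominates; the linear terms are absorbed by n ≤ 1 + n ⌈log₂ n⌉.
  total-bound : ι 5 + phasesBound n ≤ ι (53 * suc (n * ⌈log₂ n ⌉))
  total-bound = begin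
    ι 5 + phasesBound n
      ≤⟨ +-monoʳ-≤ (ι 5) (+-monoʳ-≤ 1ℚ (+-monoʳ-≤ (ι n) (·-monoʳ-≤ (0≤ι (26 * n)) (H≤1+log n)))) ⟩
    ι 5 + (1ℚ + (ι n + ι (26 * n) · (1ℚ + ι L)))
      ≡⟨ cong (λ z → ι 5 + (1ℚ + (ι n + z · (1ℚ + ι L)))) (ι-* 26 n) ⟩
    ι 5 + (1ℚ + (ι n + ι 26 · ι n · (1ℚ + ι L)))
      ≡⟨ solve 2 (λ i l → con (ι 5) :+ (con 1ℚ :+ (i :+ con (ι 26) :* i :* (con 1ℚ :+ l)))
           := con (ι 6) :+ con (ι 27) :* i :+ con (ι 26) :* (i :* l)) refl (ι n) (ι L) ⟩
    ι 6 + ι 27 · ι n + ι 26 · (ι n · ι L)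
      ≤⟨ +-mono-≤ (+-mono-≤ (ι-mono {6} {26} (ℕ.m≤m+n 6 20)) (·-monoʳ-≤ (0≤ι 27) (ι-mono (n≤1+n*log n)))) ≤-refl ⟩
    ι 26 + ι 27 · ι (suc (n * L)) + ι 26 · (ι n · ι L)
      ≡⟨ cong₂ (λ y z → ι 26 + ι 27 · y + ι 26 · z) (ι-suc (n * L)) (sym (ι-* n L)) ⟩
    ι 26 + ι 27 · (1ℚ + ι (n * L)) + ι 26 · ι (n * L)
      ≡⟨ solve 1 (λ x → con (ι 26) :+ con (ι 27) :* (con 1ℚ :+ x) :+ con (ι 26) :* x := con (ι 53) :* (con 1ℚ :+ x)) refl (ι (n * L)) ⟩
    ι 53 · (1ℚ + ι (n * L))
      ≡⟨ trans (ι-* 53 (suc (n * L))) (cong (_·_ (ι 53)) (ι-suc (n * L))) ⟨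
    ι (53 * suc (n * L)) ∎
    where
    open ≤-Reasoning
    open +-*-Solver
    L = ⌈log₂ n ⌉

finds-matching-fast : ∀ n d .{{_ : NonZero d}} (G : BipartiteGraph n n) → Regular d G →
  (A : AdjacencyArrays n d) → Represents A G →
  FindsPerfectMatching A program G × ExpectedTime≤ A program (ι (53 * suc (n * ⌈log₂ n ⌉)))
finds-matching-fast n d G regular A represents =
  (λ N → correct (upTo (safe n d regular represents N) ℕ.≤-refl)) ,
  (λ N → fast (upTo (safe n d regular represents N) ℕ.≤-refl))
  where
  open Machine using (correct; fast; upTo)
  safe : ∀ n d .{{_ : NonZero d}} {G : BipartiteGraph n n} → Regular d G →
         {A : AdjacencyArrays n d} → Represents A G → ∀ N →
         Machine.Safe A program (λ c → PerfectMatching G (output A program c))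
           N (initial A program) (ι (53 * suc (n * ⌈log₂ n ⌉)))
  -- The rules for random draws need a nonempty range, so n = 0, where the program
  -- halts after six instructions, is separate.
  safe zero d {G} regular {A} represents N =
    safe-weaken (ι-mono {6} {53} (ℕ.m≤m+n 6 47)) (straight 6 refl (safe-halt refl empty))
    where
    open Machine A program (λ c → PerfectMatching G (output A program c))
    empty : ∀ {M} → PerfectMatching G M
    empty = record { edges = λ { {()} } ; coverP = λ () ; coverQ = λ () }
  safe (suc n₁) (suc d₁) {G} regular {A} represents N = safe-weaken total-bound (safe-initial N)
    where
    open Machine A program (λ c → PerfectMatching G (output A program c))
    open Algorithm regular represents

theorem1 : ∃ λ (p : Program) → ∃ λ (C : ℕ) →
    ∀ (n d : ℕ) .{{_ : NonZero d}}
    (G : BipartiteGraph n n) → Regular d G →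
    (A : AdjacencyArrays n d) → Represents A G →
    FindsPerfectMatching A p G
    × ExpectedTime≤ A p (+ (C * suc (n * ⌈log₂ n ⌉)) / 1)
theorem1 = program , 53 , finds-matching-fast
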